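{- There is a function $f\colon \mathbb{N}\to\mathbb{N}$ with $f(k)=k^{\mathcal{O}(k)}$ such that the following holds. Let $k,\rho$ be positive integers and let $G$ be a $(k,\rho)$-geodesic-coverable graph. Then: (1) $G$ is $(3,12\rho)$-quasi-isometric to a graph of pathwidth at most $f(k)$ and maximum degree less than $26k$; (2) the vertex set of $G$ can be partitioned into parts $C_1,C_2,\ldots,C_\ell$ such that every part $C_i$ can be covered by at most $f(k)$ balls of radius $2\rho$ (i.e., there is a set $D_i\subseteq V(G)$ with $|D_i|\le f(k)$ such that every vertex of $C_i$ is at distance at most $2\rho$ from some vertex of $D_i$), and every two vertices $u,v$ with $\mathrm{dist}(u,v)\le 2\rho$ belong to the same part or to two consecutive parts $C_i,C_{i+1}$.
   Context: Graphs are finite, undirected and unweighted; $\mathrm{dist}(u,v)$ is the shortest-path distance. A geodesic is a path that is a shortest path between its endpoints. A graph $G$ is $(k,\rho)$-geodesic-coverable if there is a family $\mathcal{P}$ of $k$ geodesics in $G$ such that every vertex of $G$ is at distance at most $\rho$ from some vertex of some path in $\mathcal{P}$. For graphs $G,H$, a map $\varphi\colon V(G)\to V(H)$ is an $(m,a)$-quasi-isometry if for all $u,v\in V(G)$, $m^{ -1}\mathrm{dist}_G(u,v)-a\le \mathrm{dist}_H(\varphi(u),\varphi(v))\le m\,\mathrm{dist}_G(u,v)+a$, and for every $w\in V(H)$ there is $u\in V(G)$ with $\mathrm{dist}_H(w,\varphi(u))\le a$; $G$ is $(m,a)$-quasi-isometric to $H$ if such a map exists. Pathwidth is the usual notion (a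 path-decomposition $D_1,\dots,D_\ell$ covers every edge by some bag and satisfies $D_i\cap D_k\subseteq D_j$ for $i\le j\le k$; width is the maximum bag size as defined in the paper). -}

module Defs where

open import Data.Nat using (ℕ; zero; suc; _+_; _*_; _^_; _≤_; _<_)
open import Data.Fin using (Fin; toℕ; fromℕ)
open import Data.Fin.Subset using (Subset; _∈_; ∣_∣)
open import Data.Vec using (tabulate)
open import Data.Bool using (Bool; true; false)
open import Data.List using (List; length)
import Data.List.Membership.Propositional as LM
open import Data.Product using (Σ; ∃; ∃-syntax; _×_; _,_)
open import Data.Sum using (_⊎_)
open import Relation.Binary.PropositionalEquality using (_≡_)

record Graph : Set where
  field
    n    : ℕ
    adj  : Fin n → Fin n → Bool
    sym  : ∀ u v → adj u v ≡ adj v u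
    irr  : ∀ v → adj v v ≡ false
open Graph public

V : Graph → Set
V G = Fin (n G)

data Walk (G : Graph) : V G → V G → ℕ → Set where
  here : ∀ {u} → Walk G u u 0
  step : ∀ {u w v L} → adj G u w ≡ true → Walk G w v L → Walk G u v (suc L)

-- dist_G(u,v) ≤ d  (dist may be infinite if G is disconnected)
DistLe : (G : Graph) → V G → V G → ℕ → Set
DistLe G u v d = ∃[ L ] (L ≤ d × Walk G u v L)

record Geodesic (G : Graph) : Set where
  field
    len      : ℕ
    vtx      : Fin (suc len) → V G
    adjacent : ∀ (i : Fin len) → adj G (vtx (Data.Fin.inject₁ i)) (vtx (Data.Fin.suc i)) ≡ true
    shortest : ∀ d → DistLe G (vtx Data.Fin.zero) (vtx (fromℕ len)) d → len ≤ d
open Geodesic public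

GeodesicCoverable : Graph → ℕ → ℕ → Set
GeodesicCoverable G k ρ =
  Σ (Fin k → Geodesic G) λ P →
    ∀ (v : V G) → ∃[ i ] ∃[ j ] DistLe G v (vtx (P i) j) ρ

-- (m,a)-quasi-isometry φ : V(G) → V(H)
-- lower bound  m⁻¹ dist_G(u,v) − a ≤ dist_H(φu,φv)  ⇔  dist_G(u,v) ≤ m·dist_H(φu,φv) + m·a
IsQuasiIsometry : (G H : Graph) → ℕ → ℕ → (V G → V H) → Set
IsQuasiIsometry G H m a φ =
  (∀ u v d → DistLe H (φ u) (φ v) d → DistLe G u v (m * d + m * a)) ×
  (∀ u v d → DistLe G u v d → DistLe H (φ u) (φ v) (m * d + a)) ×
  (∀ (w : V H) → ∃[ u ] DistLe H w (φ u) a)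

QuasiIsometric : Graph → Graph → ℕ → ℕ → Set
QuasiIsometric G H m a = Σ (V G → V H) (IsQuasiIsometry G H m a)

record PathDecomposition (G : Graph) : Set where
  field
    ℓ       : ℕ
    bag     : Fin ℓ → Subset (n G)
    vcover  : ∀ (v : V G) → ∃[ i ] (v ∈ bag i)
    ecover  : ∀ (u v : V G) → adj G u v ≡ true → ∃[ i ] (u ∈ bag i × v ∈ bag i)
    interp  : ∀ (i j k : Fin ℓ) (v : V G) → toℕ i ≤ toℕ j → toℕ j ≤ toℕ k →
              v ∈ bag i → v ∈ bag k → v ∈ bag j
open PathDecomposition public

-- width = maximum bag size (convention of the paper)
HasWidthAtMost : {G : Graph} → PathDecomposition G → ℕ → Set
HasWidthAtMost D w = ∀ i → ∣ bag D i ∣ ≤ w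

PathwidthAtMost : Graph → ℕ → Set
PathwidthAtMost G w = Σ (PathDecomposition G) λ D → HasWidthAtMost D w

degree : (G : Graph) → V G → ℕ
degree G v = ∣ tabulate (adj G v) ∣

MaxDegreeLessThan : Graph → ℕ → Set
MaxDegreeLessThan G b = ∀ v → degree G v < b

IsKToTheOk : (ℕ → ℕ) → Set
IsKToTheOk f = ∃[ c ] ∃[ k₀ ] (∀ k → k₀ ≤ k → f k ≤ k ^ (c * k))

GoodPartition : Graph → ℕ → ℕ → Set
GoodPartition G ρ F =
  ∃[ ℓ ] Σ (V G → Fin ℓ) λ part →
    (∀ i → ∃[ v ] part v ≡ i) ×
    (∀ i → ∃[ D ] (length D ≤ F ×
        (∀ v → part v ≡ i → ∃[ x ] (x LM.∈ D × DistLe G v x (2 * ρ))))) ×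
    (∀ u v → DistLe G u v (2 * ρ) →
        (toℕ (part u) ≡ toℕ (part v)) ⊎ (toℕ (part u) ≡ suc (toℕ (part v)))
          ⊎ (suc (toℕ (part u)) ≡ toℕ (part v)))

{-# OPTIONS --safe #-}
module Submission where

-- Let h be the distance to the nearest first vertex of a covering geodesic. A shortest path from v down
-- to such a vertex can be compressed to at most k runs along distinct covering geodesics; recording for
-- each run the geodesic and whether it goes forward, backward or is short gives a word for v. If u and v
-- have the same word, then dist(u,v) ≤ |h(u) - h(v)| + k^O(k) ρ, by induction on the word: two long runs
-- in the same direction along one geodesic, both increasing h at full speed, cannot be misaligned.
-- Hence a window of O(ρ) consecutive values of h contains only k^O(k) points of the (ρ+1)-net taken along
-- the covering geodesics. Windows of h give the partition. Joining net points at distance at most 6ρ by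
-- paths of length 6ρ gives the graph of part (1), and interpolating h along these paths gives its
-- path-decomposition; each geodesic contributes at most 12 net points to a ball of radius 6ρ.

open import Defs
open import Data.Bool using (Bool; true; false)
import Data.Bool.Properties as Bool
open import Data.Fin as Fin using (Fin; toℕ; fromℕ; fromℕ<; inject₁; combine; funToFin)
open import Data.Fin.Patterns using (0F; 1F; 2F; 3F)
import Data.Fin.Properties as Fin
open import Data.Fin.Subset using (Subset; ∣_∣; _∈_; _-_; ⊤)
import Data.Fin.Subset.Properties as Subset
open import Data.List as List using ([]; _∷_; length)
import Data.List.Properties as List
open import Data.List.Membership.Propositional using () renaming (_∈_ to _∈ˡ_)
import Data.List.Membership.Propositional.Properties as Membership
open import Data.Nat
open import Data.Nat.DivMod
open import Data.Nat.Divisibility using (∣-refl)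
open import Data.Nat.Properties
open import Data.Nat.Tactic.RingSolver using (solve-∀; solve)
open import Data.Product using (Σ; ∃; ∃-syntax; _×_; _,_; proj₁; proj₂; uncurry)
open import Data.Product.Function.NonDependent.Propositional using (_×-↔_)
open import Data.Sum using (_⊎_; inj₁; inj₂; [_,_]′)
open import Data.Vec as Vec using (Vec; tabulate; lookup; replicate)
import Data.Vec.Properties as Vec
open import Function using (_∘_; Injective)
open import Function.Bundles using (_↔_; Inverse)
open import Function.Properties.Inverse using (↔-refl; ↔-trans)
open import Relation.Binary.Definitions using (tri<; tri≈; tri>)
open import Relation.Binary.PropositionalEquality
  using (_≡_; _≢_; refl; cong; cong₂; subst; subst₂; trans; module ≡-Reasoning) renaming (sym to ≡-sym)
open import Relation.Nullary using (¬_; Dec; yes; no; does; contradiction)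
open import Relation.Nullary.Decidable using (map′; _×-dec_; _⊎-dec_; ¬?; dec-true; dec-false)

-- Additive arithmetic of differences, quotients and residues

-- Linear arithmetic by certificate: A ≤ B is a combination of hypotheses, c the slack.
lin : ∀ {A B} a b c → A ≤ B → a + B + c ≡ b + A → a ≤ b
lin {A} {B} a b c A≤B eq = +-cancelʳ-≤ A a b (begin
  a + A      ≤⟨ +-monoʳ-≤ a A≤B ⟩
  a + B      ≤⟨ m≤m+n (a + B) c ⟩
  a + B + c  ≡⟨ eq ⟩
  b + A      ∎)
  where open ≤-Reasoning

infixl 6 _⊞_
_⊞_ : ∀ {a b c d} → a ≤ b → c ≤ d → a + c ≤ b + d
_⊞_ = +-mono-≤

-- This is |p - q| ≤ d, kept additive so that truncated subtraction stays out of the certificates.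
Within : ℕ → ℕ → ℕ → Set
Within p q d = p ≤ q + d × q ≤ p + d

within-sym : ∀ {p q d} → Within p q d → Within q p d
within-sym (a , b) = b , a

within-weaken : ∀ {p q d e} → d ≤ e → Within p q d → Within p q e
within-weaken {p} {q} d≤e (a , b) = ≤-trans a (+-monoʳ-≤ q d≤e) , ≤-trans b (+-monoʳ-≤ p d≤e)

within-trans : ∀ {p q r} d e → Within p q d → Within q r e → Within p r (d + e)
within-trans {p} {q} {r} d e (a , b) (c , f) =
    lin p (r + (d + e)) 0 (a ⊞ c) (solve (p ∷ q ∷ r ∷ d ∷ e ∷ []))
  , lin r (p + (d + e)) 0 (b ⊞ f) (solve (p ∷ q ∷ r ∷ d ∷ e ∷ []))

within-≡ : ∀ {p q} d → q ≡ p + d → Within p q d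
within-≡ {p} d refl = ≤-trans (m≤m+n p d) (m≤m+n (p + d) d) , ≤-refl

within? : ∀ p q d → Dec (Within p q d)
within? p q d = p ≤? q + d ×-dec q ≤? p + d

/-lipschitz : ∀ {p q} r .{{_ : NonZero r}} → Within p q r → Within (p / r) (q / r) 1
/-lipschitz r (p≤ , q≤) = bound p≤ , bound q≤
  where
  bound : ∀ {a b} → a ≤ b + r → a / r ≤ b / r + 1
  bound {a} {b} le = ≤-trans (/-monoˡ-≤ r le)
    (≤-reflexive (trans (+-distrib-/-∣ʳ b ∣-refl) (cong (b / r +_) (n/n≡1 r))))

within-one : ∀ {p q} → Within p q 1 → p ≡ q ⊎ p ≡ suc q ⊎ suc p ≡ q
within-one {p} {q} (p≤ , q≤) with <-cmp p q
... | tri≈ _ p≡q _ = inj₁ p≡q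
... | tri< p<q _ _ = inj₂ (inj₂ (≤-antisym p<q (subst (q ≤_) (+-comm p 1) q≤)))
... | tri> _ _ q<p = inj₂ (inj₁ (≤-antisym (subst (p ≤_) (+-comm q 1) p≤) q<p))

≤⇒≡+ : ∀ {m n} → m ≤ n → ∃ λ d → n ≡ m + d
≤⇒≡+ {m} {n} m≤n = n ∸ m , ≡-sym (m+[n∸m]≡n m≤n)

private
  -- Equal remainders make the difference a multiple of `K`, so unequal quotients would put `q` at
  -- least `K` above `p`.
  %-≤-injective : ∀ {p q} K .{{_ : NonZero K}} → p % K ≡ q % K → q < p + K → p / K ≤ q / K → p ≡ q
  %-≤-injective {p} {q} K eq q<p+K le with m≤n⇒m<n∨m≡n le
  ... | inj₂ eq/ = begin
      p                    ≡⟨ m≡m%n+[m/n]*n p K ⟩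
      p % K + (p / K) * K  ≡⟨ cong₂ (λ a b → a + b * K) eq eq/ ⟩
      q % K + (q / K) * K  ≡⟨ m≡m%n+[m/n]*n q K ⟨
      q                    ∎
    where open ≡-Reasoning
  ... | inj₁ lt = contradiction (begin
      p + K                      ≡⟨ cong (_+ K) (m≡m%n+[m/n]*n p K) ⟩
      p % K + (p / K) * K + K    ≡⟨ +-assoc (p % K) ((p / K) * K) K ⟩
      p % K + ((p / K) * K + K)  ≡⟨ cong₂ _+_ eq (+-comm ((p / K) * K) K) ⟩
      q % K + suc (p / K) * K    ≤⟨ +-monoʳ-≤ (q % K) (*-monoˡ-≤ K lt) ⟩
      q % K + (q / K) * K        ≡⟨ m≡m%n+[m/n]*n q K ⟨
      q                          ∎) (<⇒≱ q<p+K)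
    where open ≤-Reasoning

%-within-injective : ∀ {p q} K .{{_ : NonZero K}} → p % K ≡ q % K → p < q + K → q < p + K → p ≡ q
%-within-injective {p} {q} K eq p<q+K q<p+K with ≤-total (p / K) (q / K)
... | inj₁ le = %-≤-injective K eq q<p+K le
... | inj₂ le = ≡-sym (%-≤-injective K (≡-sym eq) p<q+K le)

-- Finite enumeration, counting and minimisation

record Enumerates {A : Set} (P : A → Set) (m : ℕ) : Set where
  field
    elem      : Fin m → A
    sound     : ∀ i → P (elem i)
    injective : Injective _≡_ _≡_ elem
    complete  : ∀ a → P a → ∃ λ i → elem i ≡ a

enumerate-true : ∀ {n} (p : Fin n → Bool) → Enumerates (λ i → p i ≡ true) ∣ tabulate p ∣
enumerate-true {zero} p = record
  { elem = λ (); sound = λ (); injective = λ { {()} }; complete = λ () }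
enumerate-true {suc n} p with p Fin.zero in eq | enumerate-true (p ∘ Fin.suc)
... | false | rec = record
  { elem      = Fin.suc ∘ elem
  ; sound     = sound
  ; injective = injective ∘ Fin.suc-injective
  ; complete  = λ { Fin.zero pa → contradiction (trans (≡-sym pa) eq) λ ()
                  ; (Fin.suc a) pa → let i , q = complete a pa in i , cong Fin.suc q } }
  where open Enumerates rec
... | true | rec = record
  { elem      = λ { Fin.zero → Fin.zero ; (Fin.suc i) → Fin.suc (elem i) }
  ; sound     = λ { Fin.zero → eq ; (Fin.suc i) → sound i }
  ; injective = λ { {Fin.zero} {Fin.zero} _ → refl
                  ; {Fin.suc _} {Fin.suc _} q → cong Fin.suc (injective (Fin.suc-injective q)) }
  ; complete  = λ { Fin.zero _ → Fin.zero , refl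
                  ; (Fin.suc a) pa → let i , q = complete a pa in Fin.suc i , cong Fin.suc q } }
  where open Enumerates rec

does-true : ∀ {P : Set} (P? : Dec P) → does P? ≡ true → P
does-true (yes p) _ = p

enumerate-dec : ∀ {A : Set} {n} {P : A → Set} → Fin n ↔ A → (∀ a → Dec (P a)) → ∃ (Enumerates P)
enumerate-dec {P = P} iso P? = _ , record
  { elem      = to ∘ elem
  ; sound     = λ i → does-true (P? _) (sound i)
  ; injective = λ q → injective (trans (≡-sym (strictlyInverseʳ _)) (trans (cong from q) (strictlyInverseʳ _)))
  ; complete  = λ a pa → let i , q = complete (from a) (dec-true (P? _) (subst P (≡-sym (strictlyInverseˡ a)) pa))
                         in i , trans (cong to q) (strictlyInverseˡ a) }
  where
  open Inverse iso
  open Enumerates (enumerate-true (λ i → does (P? (to i))))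

-- The bounds on degrees and bag sizes come from here: listing the subset and coding its elements
-- gives an injection between `Fin` types.
∣tabulate∣≤ : ∀ {n M} (p : Fin n → Bool) (code : Fin n → Fin M) →
              (∀ i j → p i ≡ true → p j ≡ true → code i ≡ code j → i ≡ j) → ∣ tabulate p ∣ ≤ M
∣tabulate∣≤ p code inj = Fin.injective⇒≤ {f = code ∘ elem} λ {i} {j} q →
  injective (inj _ _ (sound i) (sound j) q)
  where open Enumerates (enumerate-true p)

least : ∀ {P : ℕ → Set} → (∀ n → Dec (P n)) → ∀ n → P n → ∃ λ m → P m × (∀ i → P i → m ≤ i)
least {P} P? n pn with P? 0
... | yes p0 = 0 , p0 , λ _ _ → z≤n
least P? zero p0 | no ¬p0 = contradiction p0 ¬p0
least {P} P? (suc n) pn | no ¬p0 =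
  let m , pm , minimal = least (P? ∘ suc) n pn
  in suc m , pm , λ { zero p0 → contradiction p0 ¬p0 ; (suc i) pi → s≤s (minimal i pi) }

bounded : ∀ {n} (f : Fin n → ℕ) → ∃ λ B → ∀ i → f i ≤ B
bounded {zero} f = 0 , λ ()
bounded {suc n} f =
  let B , f≤B = bounded (f ∘ Fin.suc)
  in f Fin.zero ⊔ B , λ { Fin.zero → m≤m⊔n _ _ ; (Fin.suc i) → ≤-trans (f≤B i) (m≤n⊔m _ _) }

-- Walks, distances and positions along geodesics

module _ {G : Graph} where

  walk-++ : ∀ {u v w a b} → Walk G u v a → Walk G v w b → Walk G u w (a + b)
  walk-++ here W = W
  walk-++ (step e W′) W = step e (walk-++ W′ W)

  walk-∷ʳ : ∀ {u v w a} → Walk G u v a → adj G v w ≡ true → Walk G u w (suc a)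
  walk-∷ʳ here e = step e here
  walk-∷ʳ (step e′ W) e = step e′ (walk-∷ʳ W e)

  walk-sym : ∀ {u v a} → Walk G u v a → Walk G v u a
  walk-sym here = here
  walk-sym (step e W) = walk-∷ʳ (walk-sym W) (trans (Graph.sym G _ _) e)

  walk-split : ∀ {u v} a {b} → Walk G u v (a + b) → ∃ λ w → Walk G u w a × Walk G w v b
  walk-split zero W = _ , here , W
  walk-split (suc a) (step e W) = let w , A , B = walk-split a W in w , step e A , B

  dist-walk : ∀ {u v d} → Walk G u v d → DistLe G u v d
  dist-walk W = _ , ≤-refl , W

  dist-refl : ∀ {v d} → DistLe G v v d
  dist-refl = 0 , z≤n , here

  dist-sym : ∀ {u v d} → DistLe G u v d → DistLe G v u d
  dist-sym (L , L≤d , W) = L , L≤d , walk-sym W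

  dist-trans : ∀ {u v w d e} → DistLe G u v d → DistLe G v w e → DistLe G u w (d + e)
  dist-trans (a , a≤d , A) (b , b≤e , B) = a + b , +-mono-≤ a≤d b≤e , walk-++ A B

  dist-weaken : ∀ {u v d e} → d ≤ e → DistLe G u v d → DistLe G u v e
  dist-weaken d≤e (L , L≤d , W) = L , ≤-trans L≤d d≤e , W

  dist-edge : ∀ {u v d} → adj G u v ≡ true → 1 ≤ d → DistLe G u v d
  dist-edge e 1≤d = 1 , 1≤d , step e here

  dist? : ∀ u v d → Dec (DistLe G u v d)
  dist? u v zero = map′ (λ { refl → dist-refl }) (λ { (_ , z≤n , here) → refl }) (u Fin.≟ v)
  dist? u v (suc d) = map′
    (λ { (inj₁ refl) → dist-refl
       ; (inj₂ (w , e , L , L≤d , W)) → suc L , s≤s L≤d , step e W })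
    (λ { (_ , _ , here) → inj₁ refl
       ; (_ , s≤s L≤d , step e W) → inj₂ (_ , e , _ , L≤d , W) })
    (u Fin.≟ v ⊎-dec Fin.any? λ w → (adj G u w Bool.≟ true) ×-dec dist? w v d)

  sequence-walk : ∀ {n} (p : Fin (suc n) → V G) →
                  (∀ i → adj G (p (inject₁ i)) (p (Fin.suc i)) ≡ true) →
                  ∀ i j d → toℕ j ≡ toℕ i + d → Walk G (p i) (p j) d
  sequence-walk p e Fin.zero Fin.zero .0 refl = here
  sequence-walk {suc n} p e Fin.zero (Fin.suc j) .(suc (toℕ j)) refl =
    step (e Fin.zero) (sequence-walk (p ∘ Fin.suc) (e ∘ Fin.suc) Fin.zero j _ refl)
  sequence-walk {suc n} p e (Fin.suc i) (Fin.suc j) d eq =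
    sequence-walk (p ∘ Fin.suc) (e ∘ Fin.suc) i j d (suc-injective eq)

  module _ (P : Geodesic G) where

    geodesic-walk : ∀ i j d → toℕ j ≡ toℕ i + d → Walk G (vtx P i) (vtx P j) d
    geodesic-walk = sequence-walk (vtx P) (adjacent P)

    within⇒dist : ∀ i j {d} → Within (toℕ i) (toℕ j) d → DistLe G (vtx P i) (vtx P j) d
    within⇒dist i j (i≤j+d , j≤i+d) with ≤-total (toℕ i) (toℕ j)
    ... | inj₁ i≤j = let c , eq = ≤⇒≡+ i≤j in
      c , +-cancelˡ-≤ (toℕ i) c _ (subst (_≤ _) eq j≤i+d) , geodesic-walk i j c eq
    ... | inj₂ j≤i = let c , eq = ≤⇒≡+ j≤i in
      c , +-cancelˡ-≤ (toℕ j) c _ (subst (_≤ _) eq i≤j+d) , walk-sym (geodesic-walk j i c eq)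

    private
      -- Follow the path to `i`, the given walk to `j`, and the path again to its end: a shortcut
      -- between `i` and `j` would shorten the whole geodesic.
      geodesic-shortest : ∀ i j {d} → DistLe G (vtx P i) (vtx P j) d → toℕ j ≤ toℕ i + d
      geodesic-shortest i j {d} ij =
        let c , eq = ≤⇒≡+ (Fin.toℕ≤pred[n] j)
            len≤ = shortest P (toℕ i + d + c) (dist-trans (dist-trans
                     (dist-walk (geodesic-walk Fin.zero i (toℕ i) refl)) ij)
                     (dist-walk (geodesic-walk j (fromℕ (len P)) c (trans (Fin.toℕ-fromℕ _) eq))))
        in +-cancelʳ-≤ c (toℕ j) (toℕ i + d) (subst (_≤ toℕ i + d + c) eq len≤)

    dist⇒within : ∀ i j {d} → DistLe G (vtx P i) (vtx P j) d → Within (toℕ i) (toℕ j) d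
    dist⇒within i j ij = geodesic-shortest j i (dist-sym ij) , geodesic-shortest i j ij

-- Arithmetic for comparing two runs

-- Two runs along one geodesic in the same direction, from positions b ≤ b + x and b₂ ≤ b₂ + x₂ at
-- heights t and t + ζ, gaining height d and d₂. If the second starts behind the first although it is
-- higher, it would have to climb towards a lower point: impossible unless the starts almost agree.
directed-arithmetic : ∀ {t ζ d d₂ b b₂ x x₂ e s η} →
  d ≤ x + s → x ≤ d + s → d₂ ≤ x₂ + s → x₂ ≤ d₂ + s →
  Within b b₂ (ζ + e + s) →
  (∀ y → Within b b₂ y → ζ ≤ y + s) →
  (∀ y → Within b (b₂ + x₂) y → ζ + d₂ ≤ y + s) →
  e + s + s < d₂ →
  Within (t + d) (t + ζ + d₂) η →
  Within (b + x) (b₂ + x₂) (η + e + (s + s + s + s))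
directed-arithmetic {t} {ζ} {d} {d₂} {b} {b₂} {x} {x₂} {e} {s} {η}
  d≤ x≤ d₂≤ x₂≤ (b≤ , b₂≤) starts climb long (h≤ , h₂≤) with ≤-total b b₂
... | inj₁ b≤b₂ with δ , refl ← ≤⇒≡+ b≤b₂ =
    lin (b + x) (b + δ + x₂ + (η + e + (s + s + s + s))) (e + s) (starts δ (within-≡ δ refl) ⊞ x≤ ⊞ d₂≤ ⊞ h≤)
      (solve (t ∷ ζ ∷ d ∷ d₂ ∷ b ∷ δ ∷ x ∷ x₂ ∷ e ∷ s ∷ η ∷ []))
  , lin (b + δ + x₂) (b + x + (η + e + (s + s + s + s))) s (b₂≤ ⊞ d≤ ⊞ x₂≤ ⊞ h₂≤)
      (solve (t ∷ ζ ∷ d ∷ d₂ ∷ b ∷ δ ∷ x ∷ x₂ ∷ e ∷ s ∷ η ∷ []))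
... | inj₂ b₂≤b with δ , refl ← ≤⇒≡+ b₂≤b with ≤-total δ x₂
...   | inj₁ δ≤x₂ with y , refl ← ≤⇒≡+ δ≤x₂ =
    lin (b₂ + δ + x) (b₂ + (δ + y) + (η + e + (s + s + s + s))) e (overtaken ⊞ x≤ ⊞ d₂≤ ⊞ h≤)
      (solve (t ∷ ζ ∷ d ∷ d₂ ∷ b₂ ∷ δ ∷ x ∷ y ∷ e ∷ s ∷ η ∷ []))
  , lin (b₂ + (δ + y)) (b₂ + δ + x + (η + e + (s + s + s + s))) (s + s + e + δ + ζ) (d≤ ⊞ h₂≤ ⊞ x₂≤)
      (solve (t ∷ ζ ∷ d ∷ d₂ ∷ b₂ ∷ δ ∷ x ∷ y ∷ e ∷ s ∷ η ∷ []))
  where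
  -- The second run passes `b` after δ. By `climb` the remaining `y` must supply ζ + d₂ up to `s`,
  -- while the whole run δ + y is at most d₂ + s; so δ and ζ are both small.
  overtaken : ζ + δ ≤ s + s
  overtaken = lin (ζ + δ) (s + s) 0
    (climb y (within-≡ y (≡-sym (+-assoc b₂ δ y))) ⊞ x₂≤) (solve (ζ ∷ δ ∷ s ∷ d₂ ∷ y ∷ []))
-- Here the second run ends before reaching `b`; `climb` and the closeness of the lower ends give d₂
-- ≤ e + 2s, against `long`.
...   | inj₂ x₂≤δ with y , refl ← ≤⇒≡+ x₂≤δ = contradiction long (≤⇒≯ (lin d₂ (e + s + s) x₂
    (climb y (within-sym (within-≡ y (≡-sym (+-assoc b₂ x₂ y)))) ⊞ b≤) (solve (ζ ∷ b₂ ∷ e ∷ s ∷ d₂ ∷ x₂ ∷ y ∷ []))))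

private
  sandwich : ∀ s d → s + d + s ≡ d + (s + s)
  sandwich = solve-∀

  regroup : ∀ η e t → η + e + (t + t + t + t) + t ≡ η + (e + (t + t + t + t) + t)
  regroup = solve-∀

  spread : ∀ θ η e → θ + (θ + (η + θ) + e) + θ ≡ η + (θ + θ + θ + θ + e)
  spread = solve-∀

  -- Since θ = e + 8ρ, the left side is 5e + 32ρ. This fixes the factor 6 and the base error 32ρ in
  -- `err`.
  short-budget : ∀ ρ e → let τ = (ρ + ρ) + (ρ + ρ); θ = e + τ + τ in
                 32 * ρ ≤ e → θ + θ + θ + θ + e ≤ 6 * e
  short-budget ρ e le = lin _ (6 * e) 0 le (identity ρ e)
    where
    identity : ∀ ρ e → let τ = (ρ + ρ) + (ρ + ρ); θ = e + τ + τ in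
               (θ + θ + θ + θ + e) + e + 0 ≡ 6 * e + 32 * ρ
    identity = solve-∀

  directed-budget : ∀ ρ e → let τ = (ρ + ρ) + (ρ + ρ) in
                    32 * ρ ≤ e → e + (τ + τ + τ + τ) + τ ≤ 6 * e
  directed-budget ρ e le = lin _ (6 * e) (12 * ρ + 4 * e) le (identity ρ e)
    where
    identity : ∀ ρ e → let τ = (ρ + ρ) + (ρ + ρ) in
               (e + (τ + τ + τ + τ) + τ) + e + (12 * ρ + 4 * e) ≡ 6 * e + 32 * ρ
    identity = solve-∀

-- Heights, descents and the words of vertices

module Cover (G : Graph) (k ρ : ℕ) (1≤ρ : 1 ≤ ρ) (P : Fin k → Geodesic G)
             (covered : ∀ (v : V G) → ∃[ i ] ∃[ j ] DistLe G v (vtx (P i) j) ρ) where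

  Position : Fin k → Set
  Position j = Fin (suc (len (P j)))

  start : Fin k → V G
  start i = vtx (P i) Fin.zero

  private
    ReachesStart : V G → ℕ → Set
    ReachesStart v d = ∃ λ i → DistLe G v (start i) d

    -- Heights are finite even in a disconnected graph: from `v` go to a covering path and back
    -- along it to its first vertex.
    nearest-start : ∀ v → ∃ λ m → ReachesStart v m × (∀ d → ReachesStart v d → m ≤ d)
    nearest-start v =
      let i , j , d = covered v
      in least (λ d → Fin.any? λ i → dist? v (start i) d) (ρ + toℕ j)
           (i , dist-trans d (dist-walk (walk-sym (geodesic-walk (P i) Fin.zero j (toℕ j) refl))))

  abstract
    height : V G → ℕ
    height v = proj₁ (nearest-start v)

    height-attained : ∀ v → ReachesStart v (height v)
    height-attained v = proj₁ (proj₂ (nearest-start v))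

    height-minimal : ∀ {v d i} → DistLe G v (start i) d → height v ≤ d
    height-minimal {v} d = proj₂ (proj₂ (nearest-start v)) _ (_ , d)

  height-lipschitz : ∀ {u v d} → DistLe G u v d → Within (height u) (height v) d
  height-lipschitz d = bound d , bound (dist-sym d)
    where
    bound : ∀ {u v d} → DistLe G u v d → height u ≤ height v + d
    bound {u} {v} {d} uv = let i , vi = height-attained v in
      subst (height u ≤_) (+-comm d (height v)) (height-minimal (dist-trans uv vi))

  -- Each edge lowers `height` by exactly one, so any stretch has length equal to its height drop
  -- and is a shortest walk.
  data Descent : V G → Set where
    root : ∀ {v} i → v ≡ start i → Descent v
    down : ∀ {v u} → adj G v u ≡ true → height v ≡ suc (height u) → Descent u → Descent v

  -- A walk to a first vertex whose length equals the height can waste no step: the bounds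
  -- `height v ≤ L` and `L ≤ height v` pass to its remainder and force a drop of one.
  descent : ∀ v → Descent v
  descent v = let i , L , L≤h , W = height-attained v in
    from-walk W (height-minimal {v} (dist-walk W)) L≤h
    where
    from-walk : ∀ {v i L} → Walk G v (start i) L → height v ≤ L → L ≤ height v → Descent v
    from-walk here _ _ = root _ refl
    from-walk {v} {i} {suc L} (step {w = u} e W) h≤ ≤h =
      down e (≤-antisym hv≤ (≤-trans (s≤s hu≤L) ≤h)) (from-walk W hu≤L (s≤s⁻¹ (≤-trans ≤h hv≤)))
      where
      hu≤L : height u ≤ L
      hu≤L = height-minimal {u} (dist-walk W)
      hv≤ : height v ≤ suc (height u)
      hv≤ = subst (height v ≤_) (+-comm (height u) 1) (proj₁ (height-lipschitz (dist-edge e ≤-refl)))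

  Near : Fin k → V G → Set
  Near j v = ∃ λ (a : Position j) → DistLe G v (vtx (P j) a) ρ

  near? : ∀ j v → Dec (Near j v)
  near? j v = Fin.any? λ a → dist? v (vtx (P j) a) ρ

  NearSome : Subset k → V G → Set
  NearSome S v = ∃ λ j → j ∈ S × Near j v

  -- `S` holds the paths still available. Each run removes one of them, which limits a word to `k`
  -- runs.
  AllNear : ∀ {v} → Subset k → Descent v → Set
  AllNear {v} S (root _ _)   = NearSome S v
  AllNear {v} S (down _ _ D) = NearSome S v × AllNear S D

  allNear-⊤ : ∀ {v} (D : Descent v) → AllNear ⊤ D
  allNear-⊤ {v} (root _ _)   = let j , a , d = covered v in j , Subset.∈⊤ , a , d
  allNear-⊤ {v} (down _ _ D) = (let j , a , d = covered v in j , Subset.∈⊤ , a , d) , allNear-⊤ D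

  -- A tail starts one edge after a vertex within ρ of the path, hence within 1 + ρ ≤ 2ρ of it.
  σ : ℕ
  σ = ρ + ρ

  -- The first alternative of `rest` is for a descent whose very last vertex is close to `P j`;
  -- nothing then remains after it.
  record Tail (S : Subset k) (j : Fin k) (v : V G) : Set where
    field
      {end}  : V G
      to     : Position j
      near   : DistLe G end (vtx (P j) to) σ
      {drop} : ℕ
      dist   : DistLe G v end drop
      fall   : height v ≡ height end + drop
      rest   : (∃ λ i → end ≡ start i) ⊎ Σ (Descent end) (AllNear (S - j))

  avoids : ∀ {S j v} → ¬ Near j v → NearSome S v → NearSome (S - j) v
  avoids ¬n (i , i∈S , n) = i , Subset.x∈p∧x≢y⇒x∈p-y i∈S (λ { refl → ¬n n }) , n

  -- The tail starts after the last vertex of the descent that is close to P j.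
  tail-after : ∀ S j {v} (D : Descent v) → AllNear S D → AllNear (S - j) D ⊎ Tail S j v
  tail-after S j {v} (root i eq) ns with near? j v
  ... | no ¬n      = inj₁ (avoids ¬n ns)
  ... | yes (a , d) = inj₂ record
    { to = a; near = dist-weaken (m≤m+n ρ ρ) d; dist = dist-refl {d = 0}; fall = ≡-sym (+-identityʳ _)
    ; rest = inj₁ (i , eq) }
  tail-after S j {v} (down {u = u} e eq D) (ns , all) with tail-after S j D all
  ... | inj₂ t = inj₂ record
    { to = to; near = near; dist = dist-trans (dist-edge e ≤-refl) dist
    ; fall = trans eq (trans (cong suc fall) (≡-sym (+-suc _ _))); rest = rest }
    where open Tail t
  ... | inj₁ all′ with near? j v
  ...   | no ¬n       = inj₁ (avoids ¬n ns , all′)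
  ...   | yes (a , d) = inj₂ record
    { to = a; near = dist-trans (dist-edge (trans (Graph.sym G _ _) e) 1≤ρ) d
    ; dist = dist-edge e ≤-refl; fall = trans eq (+-comm 1 (height u)); rest = inj₂ (D , all′) }

  -- Only the two ends of a run need to be close to `P j`. With `fall`, `dist` says that the
  -- distance of the ends is exactly `drop`.
  record Step (j : Fin k) (v u : V G) : Set where
    field
      from to   : Position j
      near-from : DistLe G v (vtx (P j) from) σ
      near-to   : DistLe G u (vtx (P j) to) σ
      drop      : ℕ
      dist      : DistLe G v u drop
      fall      : height v ≡ height u + drop

  -- Passing between two vertices and their positions on a path costs σ at each end.
  τ : ℕ
  τ = σ + σ

  -- `err m` bounds the excess of distance over height difference for equal words with at most `m`
  -- runs. A long run exceeds the bound e + 2s of `directed-arithmetic`, taken with e = `err m` and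
  -- s = τ.
  err threshold : ℕ → ℕ
  err m       = 6 ^ m * (32 * ρ)
  threshold m = err m + τ + τ

  -- The letter (3F , i) ends a word at the vertex start i, and what follows it is padding; the other
  -- letters stand for one run along P j.
  data Trace : ∀ m → V G → Vec (Fin 4 × Fin k) (suc m) → Set where
    root     : ∀ {m v w} i → v ≡ start i → Trace m v ((3F , i) Vec.∷ w)
    short    : ∀ {m v u j w} (s : Step j v u) → Step.drop s ≤ threshold m →
               Trace m u w → Trace (suc m) v ((0F , j) Vec.∷ w)
    forward  : ∀ {m v u j w} (s : Step j v u) → threshold m < Step.drop s → toℕ (Step.to s) ≤ toℕ (Step.from s) →
               Trace m u w → Trace (suc m) v ((1F , j) Vec.∷ w)
    backward : ∀ {m v u j w} (s : Step j v u) → threshold m < Step.drop s → toℕ (Step.from s) ≤ toℕ (Step.to s) →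
               Trace m u w → Trace (suc m) v ((2F , j) Vec.∷ w)

  prepend : ∀ {m j v u w} → Step j v u → Trace m u w → ∃ (Trace (suc m) v)
  prepend {m} s t with Step.drop s ≤? threshold m
  ... | yes le = _ , short s le t
  ... | no gt with ≤-total (toℕ (Step.to s)) (toℕ (Step.from s))
  ...   | inj₁ le = _ , forward s (≰⇒> gt) le t
  ...   | inj₂ le = _ , backward s (≰⇒> gt) le t

  -- The current vertex is near some `j` in `S`. One run leads past the last vertex close to `P j`,
  -- and the rest is traced with the smaller set `S - j`.
  trace : ∀ m S → ∣ S ∣ ≤ m → ∀ {v} (D : Descent v) → AllNear S D → ∃ (Trace m v)
  -- The padding gives all words the same length, so that they can be compared and counted as
  -- vectors.
  trace m S _ (root i eq) _ = (3F , i) Vec.∷ replicate m (0F , i) , root i eq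
  trace m S S≤m D@(down _ _ _) all@((j , j∈S , a , d) , _) with <-≤-trans (Subset.x∈p⇒∣p-x∣<∣p∣ j∈S) S≤m
  ... | s≤s {n = m} S-j≤m with tail-after S j D all
  -- The type of `tail-after` does not record that `j` is near `v`; a run of drop 0 answers this
  -- case.
  ...   | inj₁ all′ = let _ , t = trace m (S - j) S-j≤m D all′ in prepend (record
    { from = a; to = a; near-from = dist-weaken (m≤m+n ρ ρ) d; near-to = dist-weaken (m≤m+n ρ ρ) d
    ; drop = 0; dist = dist-refl; fall = ≡-sym (+-identityʳ _) }) t
  ...   | inj₂ t = let _ , t = continue rest in prepend (record
    { from = a; to = to; near-from = dist-weaken (m≤m+n ρ ρ) d; near-to = near
    ; drop = drop; dist = dist; fall = fall }) t
    where
    open Tail t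
    continue : (∃ λ i → end ≡ start i) ⊎ Σ (Descent end) (AllNear (S - j)) → ∃ (Trace m end)
    continue (inj₁ (i , eq))   = (3F , i) Vec.∷ replicate m (0F , i) , root i eq
    continue (inj₂ (D , all))  = trace m (S - j) S-j≤m D all

  -- The height difference is a lower bound for the distance, as heights are 1-Lipschitz; `e` bounds
  -- the excess over it.
  Close : ℕ → V G → V G → Set
  Close e u v = ∀ {η} → Within (height u) (height v) η → DistLe G u v (η + e)

  close-weaken : ∀ {d e u v} → d ≤ e → Close d u v → Close e u v
  close-weaken d≤e c {η} w = dist-weaken (+-monoʳ-≤ η d≤e) (c w)

  close-sym : ∀ {e u v} → Close e u v → Close e v u
  close-sym c w = dist-sym (c (within-sym w))

  -- Abstracting the coordinate lets one argument serve both directions: `pos` is the index for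
  -- forward runs and the distance to the far end for backward ones.
  module Directed {j : Fin k} (pos : Position j → ℕ)
    (pos⇒dist : ∀ a b {d} → Within (pos a) (pos b) d → DistLe G (vtx (P j) a) (vtx (P j) b) d)
    (dist⇒pos : ∀ a b {d} → DistLe G (vtx (P j) a) (vtx (P j) b) d → Within (pos a) (pos b) d) where

    near⇒pos : ∀ {u v a b d} → DistLe G u (vtx (P j) a) σ → DistLe G v (vtx (P j) b) σ →
               DistLe G u v d → Within (pos a) (pos b) (d + τ)
    near⇒pos {a = a} {b} {d} ua vb uv = within-weaken (≤-reflexive (sandwich σ d))
      (dist⇒pos a b (dist-trans (dist-trans (dist-sym ua) uv) vb))

    pos⇒near : ∀ {u v a b d} → DistLe G u (vtx (P j) a) σ → DistLe G v (vtx (P j) b) σ →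
               Within (pos a) (pos b) d → DistLe G u v (d + τ)
    pos⇒near {a = a} {b} {d} ua vb w = dist-weaken (≤-reflexive (sandwich σ d))
      (dist-trans (dist-trans ua (pos⇒dist a b w)) (dist-sym vb))

    open Step

    private
      -- Drops and position gains agree up to τ, so `directed-arithmetic` applies with the lower
      -- ends at heights t and t + ζ. Returning from positions to the vertices costs the last τ.
      close-≤ : ∀ {e v u v₂ u₂} (s : Step j v u) (s₂ : Step j v₂ u₂) →
                pos (to s) ≤ pos (from s) → pos (to s₂) ≤ pos (from s₂) → e + τ + τ < drop s₂ →
                height u ≤ height u₂ → Close e u u₂ → Close (e + (τ + τ + τ + τ) + τ) v v₂
      close-≤ {e} {v} {u} {v₂} {u₂} s s₂ ≤from ≤from₂ long hu≤hu₂ c {η} w =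
        dist-weaken (≤-reflexive (regroup η e τ))
          (pos⇒near (near-from s) (near-from s₂) (subst₂ (λ a b → Within a b (η + e + (τ + τ + τ + τ))) (≡-sym a≡) (≡-sym a₂≡) positions))
        where
        ζ = proj₁ (≤⇒≡+ hu≤hu₂)
        x = proj₁ (≤⇒≡+ ≤from)
        x₂ = proj₁ (≤⇒≡+ ≤from₂)
        ζ≡ : height u₂ ≡ height u + ζ
        ζ≡ = proj₂ (≤⇒≡+ hu≤hu₂)
        a≡ : pos (from s) ≡ pos (to s) + x
        a≡ = proj₂ (≤⇒≡+ ≤from)
        a₂≡ : pos (from s₂) ≡ pos (to s₂) + x₂
        a₂≡ = proj₂ (≤⇒≡+ ≤from₂)
        cancel : ∀ {p q a d} → q ≡ p + a → q ≤ p + d → a ≤ d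
        cancel {p} {a = a} {d} refl q≤ = +-cancelˡ-≤ p a d q≤
        drop≤ : ∀ {v u x} (s : Step j v u) → pos (from s) ≡ pos (to s) + x → drop s ≤ x + τ
        drop≤ {x = x} s eq = cancel (fall s) (proj₁ (height-lipschitz
          (pos⇒near (near-from s) (near-to s) (within-sym (within-≡ x eq)))))
        ≤drop : ∀ {v u x} (s : Step j v u) → pos (from s) ≡ pos (to s) + x → x ≤ drop s + τ
        ≤drop s eq = cancel eq (proj₁ (near⇒pos (near-from s) (near-to s) (dist s)))
        fall₂ : height v₂ ≡ height u + ζ + drop s₂
        fall₂ = trans (fall s₂) (cong (_+ drop s₂) ζ≡)
        positions : Within (pos (to s) + x) (pos (to s₂) + x₂) (η + e + (τ + τ + τ + τ))
        positions = directed-arithmetic {t = height u}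
          (drop≤ s a≡) (≤drop s a≡) (drop≤ s₂ a₂≡) (≤drop s₂ a₂≡)
          (near⇒pos (near-to s) (near-to s₂) (c (within-≡ ζ ζ≡)))
          (λ y wy → cancel {p = height u} ζ≡ (proj₂ (height-lipschitz (pos⇒near (near-to s) (near-to s₂) wy))))
          (λ y wy → cancel {p = height u} (trans fall₂ (+-assoc (height u) ζ (drop s₂)))
            (proj₂ (height-lipschitz (pos⇒near (near-to s) (near-from s₂)
              (subst (λ a → Within (pos (to s)) a y) (≡-sym a₂≡) wy)))))
          long (subst₂ (λ a b → Within a b η) (fall s) fall₂ w)

    close : ∀ {e v u v₂ u₂} (s : Step j v u) (s₂ : Step j v₂ u₂) →
            pos (to s) ≤ pos (from s) → pos (to s₂) ≤ pos (from s₂) →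
            e + τ + τ < drop s → e + τ + τ < drop s₂ →
            Close e u u₂ → Close (e + (τ + τ + τ + τ) + τ) v v₂
    close {u = u} {u₂ = u₂} s s₂ ≤from ≤from₂ long long₂ c with ≤-total (height u) (height u₂)
    ... | inj₁ le = close-≤ s s₂ ≤from ≤from₂ long₂ le c
    ... | inj₂ le = close-sym (close-≤ s₂ s ≤from₂ ≤from long le (close-sym c))

  -- Going down one run and up the other costs 2θ, and the height difference of the lower ends
  -- exceeds that of the upper ones by at most another 2θ.
  close-short : ∀ {θ e j v u v₂ u₂} (s : Step j v u) (s₂ : Step j v₂ u₂) →
                Step.drop s ≤ θ → Step.drop s₂ ≤ θ → Close e u u₂ → Close (θ + θ + θ + θ + e) v v₂
  close-short {θ} {e} s s₂ d≤ d₂≤ c {η} w =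
    dist-weaken (≤-reflexive (spread θ η e))
      (dist-trans (dist-trans (dist-weaken d≤ (dist s))
        (c (within-trans θ (η + θ) (within-weaken d≤ (within-≡ _ (fall s)))
          (within-trans η θ w (within-sym (within-weaken d₂≤ (within-≡ _ (fall s₂))))))))
        (dist-sym (dist-weaken d₂≤ (dist s₂))))
    where open Step

  private
    err-suc : ∀ m → 6 * err m ≡ err (suc m)
    err-suc m = ≡-sym (*-assoc 6 (6 ^ m) (32 * ρ))

    ≤err : ∀ m → 32 * ρ ≤ err m
    ≤err m = m≤n*m (32 * ρ) (6 ^ m) {{m^n≢0 6 m}}

    reflect : ∀ {L p q p′ q′ d} → p + p′ ≡ L → q + q′ ≡ L → Within p q d → Within p′ q′ d
    reflect {L} {p} {q} {p′} {q′} {d} refl eq (a , b) =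
        lin p′ (q′ + d) 0 (b ⊞ ≤-reflexive (≡-sym eq)) (solve (p ∷ q ∷ p′ ∷ q′ ∷ d ∷ []))
      , lin q′ (p′ + d) 0 (a ⊞ ≤-reflexive eq) (solve (p ∷ q ∷ p′ ∷ q′ ∷ d ∷ []))

  -- Equal letters force the same kind of run along the same path, so runs are compared in pairs,
  -- each pair multiplying the error by 6. Both descents end at the same first vertex, where the
  -- error is zero.
  trace-close : ∀ {m v v₂ w} → Trace m v w → Trace m v₂ w → Close (err m) v v₂
  trace-close (root i refl) (root .i refl) _ = dist-refl
  trace-close {suc m} (short s d≤ t) (short s₂ d₂≤ t₂) =
    close-weaken (≤-trans (short-budget ρ (err m) (≤err m)) (≤-reflexive (err-suc m)))
      (close-short s s₂ d≤ d₂≤ (trace-close t t₂))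
  trace-close {suc m} (forward {j = j} s long ≤from t) (forward s₂ long₂ ≤from₂ t₂) =
    close-weaken (≤-trans (directed-budget ρ (err m) (≤err m)) (≤-reflexive (err-suc m)))
      (Directed.close toℕ (within⇒dist (P j)) (dist⇒within (P j))
        s s₂ ≤from ≤from₂ long long₂ (trace-close t t₂))
  trace-close {suc m} (backward {j = j} s long ≤to t) (backward s₂ long₂ ≤to₂ t₂) =
    close-weaken (≤-trans (directed-budget ρ (err m) (≤err m)) (≤-reflexive (err-suc m)))
      (Directed.close pos
        (λ a b w → within⇒dist (P j) a b (reflect (pos+ a) (pos+ b) w))
        (λ a b d → reflect (+pos a) (+pos b) (dist⇒within (P j) a b d))
        s s₂ (∸-monoʳ-≤ (len (P j)) ≤to) (∸-monoʳ-≤ (len (P j)) ≤to₂) long long₂ (trace-close t t₂))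
    where
    pos : Position j → ℕ
    pos a = len (P j) ∸ toℕ a
    pos+ : ∀ a → pos a + toℕ a ≡ len (P j)
    pos+ a = m∸n+n≡m (Fin.toℕ≤pred[n] a)
    +pos : ∀ a → toℕ a + pos a ≡ len (P j)
    +pos a = m+[n∸m]≡n (Fin.toℕ≤pred[n] a)

  word : V G → Vec (Fin 4 × Fin k) (suc k)
  word v = proj₁ (trace k ⊤ (≤-reflexive (Subset.∣⊤∣≡n k)) (descent v) (allNear-⊤ _))

  word-close : ∀ {u v} → word u ≡ word v → Close (err k) u v
  word-close {u} {v} eq = trace-close (subst (Trace k u) eq (of u)) (of v)
    where
    of : ∀ v → Trace k v (word v)
    of v = proj₂ (trace k ⊤ (≤-reflexive (Subset.∣⊤∣≡n k)) (descent v) (allNear-⊤ _))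

-- The net along the covering geodesics

-- The codes bound the number of points in a window of heights, the local codes that in a ball.
record Net (G : Graph) (ρ κ M : ℕ) : Set where
  field
    height          : V G → ℕ
    lipschitz       : ∀ {u v d} → DistLe G u v d → Within (height u) (height v) d
    convex          : ∀ v d → d ≤ height v → ∃ λ u → height u ≡ d
    size            : ℕ
    point           : Fin size → V G
    covers          : ∀ v → ∃ λ x → DistLe G v (point x) (2 * ρ)
    code            : Fin size → Fin M
    code-injective  : ∀ {x y} → code x ≡ code y → Within (height (point x)) (height (point y)) (12 * ρ) → x ≡ y
    local           : Fin size → Fin κ
    local-injective : ∀ {z x y} → DistLe G (point z) (point x) (6 * ρ) → DistLe G (point z) (point y) (6 * ρ) →
                      local x ≡ local y → x ≡ y

encode : ∀ {a b n} → Vec (Fin a × Fin b) n → Fin ((a * b) ^ n)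
encode w = funToFin (λ i → uncurry combine (lookup w i))

encode-injective : ∀ {a b n} (v w : Vec (Fin a × Fin b) n) → encode v ≡ encode w → v ≡ w
encode-injective v w eq = begin
  v                        ≡⟨ Vec.tabulate∘lookup v ⟨
  Vec.tabulate (lookup v)  ≡⟨ Vec.tabulate-cong letters ⟩
  Vec.tabulate (lookup w)  ≡⟨ Vec.tabulate∘lookup w ⟩
  w                        ∎
  where
  open ≡-Reasoning
  letters : ∀ i → lookup v i ≡ lookup w i
  letters i =
    let p , q = Fin.combine-injective _ _ _ _ (begin
          uncurry combine (lookup v i)  ≡⟨ Fin.finToFun-funToFin (uncurry combine ∘ lookup v) i ⟨
          Fin.finToFun (encode v) i     ≡⟨ cong (λ c → Fin.finToFun c i) eq ⟩
          Fin.finToFun (encode w) i     ≡⟨ Fin.finToFun-funToFin (uncurry combine ∘ lookup w) i ⟩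
          uncurry combine (lookup w i)  ∎)
    in cong₂ _,_ p q

residue : ∀ K .{{_ : NonZero K}} → ℕ → Fin K
residue K q = fromℕ< (m%n<n q K)

-- This is where spacing ρ + 1 helps: positions at most Kρ < K(ρ + 1) apart have indices less than
-- `K` apart.
residue-injective : ∀ {p q} K .{{_ : NonZero K}} ρ → residue K p ≡ residue K q →
                    Within (p * suc ρ) (q * suc ρ) (K * ρ) → p ≡ q
residue-injective {p} {q} K ρ eq (p≤ , q≤) = %-within-injective K
  (trans (≡-sym (Fin.toℕ-fromℕ< _)) (trans (cong toℕ eq) (Fin.toℕ-fromℕ< _)))
  (scale p≤) (scale q≤)
  where
  open ≤-Reasoning
  scale : ∀ {a b} → a * suc ρ ≤ b * suc ρ + K * ρ → a < b + K
  scale {a} {b} le = *-cancelʳ-< (suc ρ) a (b + K) (begin-strict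
    a * suc ρ              ≤⟨ le ⟩
    b * suc ρ + K * ρ      <⟨ +-monoʳ-< (b * suc ρ) (*-monoʳ-< K (n<1+n ρ)) ⟩
    b * suc ρ + K * suc ρ  ≡⟨ *-distribʳ-+ (suc ρ) b K ⟨
    (b + K) * suc ρ        ∎)

-- Net points with equal words and heights within 12ρ are at distance at most 12ρ + `err k`, where
-- `err k` is 32 * 6^k * ρ; and 44 = 12 + 32.
period : ℕ → ℕ
period k = 44 * 6 ^ k

-- The factors count the path, the words of k + 1 letters out of 4k, and the residues of the index
-- along the path.
codes : ℕ → ℕ
codes k = k * ((4 * k) ^ suc k * period k)

private
  window-budget : ∀ ρ p .{{_ : NonZero p}} → 12 * ρ + p * (32 * ρ) ≤ 44 * p * ρ
  window-budget ρ p = lin _ (44 * p * ρ) 0 (m≤m*n (12 * ρ) p) (identity ρ p)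
    where
    identity : ∀ ρ p → (12 * ρ + p * (32 * ρ)) + 12 * ρ * p + 0 ≡ 44 * p * ρ + 12 * ρ
    identity = solve-∀

module _ {G : Graph} {k ρ : ℕ} (1≤ρ : 1 ≤ ρ) (P : Fin k → Geodesic G)
         (covered : ∀ (v : V G) → ∃[ i ] ∃[ j ] DistLe G v (vtx (P i) j) ρ) where

  open Cover G k ρ 1≤ρ P covered

  private
    instance
      period-nonZero : NonZero (period k)
      period-nonZero = m*n≢0 44 (6 ^ k) {{_}} {{m^n≢0 6 k}}

    Slot : Set
    Slot = Fin k × Fin (suc (proj₁ (bounded (len ∘ P))))

    OnPath : Slot → Set
    OnPath (j , q) = toℕ q * suc ρ ≤ len (P j)

    slots : ∃ (Enumerates OnPath)
    slots = enumerate-dec Fin.*↔× λ _ → _ ≤? _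

    open Enumerates (proj₂ slots)

    offset : ∀ x → Position (proj₁ (elem x))
    offset x = fromℕ< (s≤s (sound x))

    toℕ-offset : ∀ x → toℕ (offset x) ≡ toℕ (proj₂ (elem x)) * suc ρ
    toℕ-offset x = Fin.toℕ-fromℕ< (s≤s (sound x))

    point : Fin (proj₁ slots) → V G
    point x = vtx (P (proj₁ (elem x))) (offset x)

    -- Reaching a path costs ρ; rounding the position down to a multiple of ρ + 1 costs at most ρ
    -- more.
    covers : ∀ v → ∃ λ x → DistLe G v (point x) (2 * ρ)
    covers v with covered v
    ... | j , a , d = x , dist-weaken (≤-reflexive (cong (ρ +_) (≡-sym (+-identityʳ ρ))))
                        (dist-trans d (subst (λ s → DistLe G (vtx (P j) a) s ρ) same near))
      where
      q = toℕ a / suc ρ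
      q*≤a : q * suc ρ ≤ toℕ a
      q*≤a = m/n*n≤m (toℕ a) (suc ρ)
      a≤len : toℕ a ≤ len (P j)
      a≤len = Fin.toℕ≤pred[n] a
      q< : q < suc (proj₁ (bounded (len ∘ P)))
      q< = s≤s (≤-trans (≤-trans (m/n≤m (toℕ a) (suc ρ)) a≤len) (proj₂ (bounded (len ∘ P)) j))
      toℕ-q : toℕ (fromℕ< q<) ≡ q
      toℕ-q = Fin.toℕ-fromℕ< q<
      slot : ∃ λ x → elem x ≡ (j , fromℕ< q<)
      slot = complete (j , fromℕ< q<) (subst (λ m → m * suc ρ ≤ len (P j)) (≡-sym toℕ-q) (≤-trans q*≤a a≤len))
      x = proj₁ slot
      b : Position j
      b = fromℕ< (s≤s (≤-trans q*≤a a≤len))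
      near : DistLe G (vtx (P j) a) (vtx (P j) b) ρ
      near = within⇒dist (P j) a b
        ( subst (λ m → toℕ a ≤ m + ρ) (≡-sym (Fin.toℕ-fromℕ< _)) (begin
            toℕ a                      ≡⟨ m≡m%n+[m/n]*n (toℕ a) (suc ρ) ⟩
            toℕ a % suc ρ + q * suc ρ  ≤⟨ +-monoˡ-≤ (q * suc ρ) (s≤s⁻¹ (m%n<n (toℕ a) (suc ρ))) ⟩
            ρ + q * suc ρ              ≡⟨ +-comm ρ (q * suc ρ) ⟩
            q * suc ρ + ρ              ∎)
        , subst (_≤ toℕ a + ρ) (≡-sym (Fin.toℕ-fromℕ< _)) (≤-trans q*≤a (m≤m+n (toℕ a) ρ)) )
        where open ≤-Reasoning
      place : ∀ {j j′} (j≡ : j ≡ j′) (b : Position j) (b′ : Position j′) → toℕ b ≡ toℕ b′ → vtx (P j) b ≡ vtx (P j′) b′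
      place refl b b′ eq = cong (vtx (P _)) (Fin.toℕ-injective eq)
      same : vtx (P j) b ≡ point x
      same = place (≡-sym (cong proj₁ (proj₂ slot))) b (offset x) (begin
        toℕ b                            ≡⟨ Fin.toℕ-fromℕ< _ ⟩
        q * suc ρ                        ≡⟨ cong (_* suc ρ) toℕ-q ⟨
        toℕ (fromℕ< q<) * suc ρ          ≡⟨ cong (λ e → toℕ (proj₂ e) * suc ρ) (proj₂ slot) ⟨
        toℕ (proj₂ (elem x)) * suc ρ     ≡⟨ toℕ-offset x ⟨
        toℕ (offset x)                   ∎)
        where open ≡-Reasoning

    same-slot : ∀ K .{{_ : NonZero K}} {x y} → proj₁ (elem x) ≡ proj₁ (elem y) →
                residue K (toℕ (proj₂ (elem x))) ≡ residue K (toℕ (proj₂ (elem y))) →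
                DistLe G (point x) (point y) (K * ρ) → x ≡ y
    same-slot K {x} {y} j≡ r≡ d = injective (cong₂ _,_ j≡ (Fin.toℕ-injective
      (residue-injective K ρ r≡ (subst₂ (λ a b → Within a b (K * ρ)) (toℕ-offset x) (toℕ-offset y)
        (along j≡ (offset x) (offset y) d)))))
      where
      along : ∀ {j j′ d} (j≡ : j ≡ j′) (b : Position j) (b′ : Position j′) →
              DistLe G (vtx (P j) b) (vtx (P j′) b′) d → Within (toℕ b) (toℕ b′) d
      along refl b b′ = dist⇒within (P _) b b′

    code : Fin (proj₁ slots) → Fin (codes k)
    code x = combine (proj₁ (elem x)) (combine (encode (word (point x))) (residue (period k) (toℕ (proj₂ (elem x)))))

    -- Two points of a ball of radius 6ρ are at most 12ρ apart, so on one path the residue modulo 12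
    -- separates them.
    local : Fin (proj₁ slots) → Fin (k * 12)
    local x = combine (proj₁ (elem x)) (residue 12 (toℕ (proj₂ (elem x))))

    -- A descent passes through every smaller height. This keeps the parts of the partition
    -- nonempty.
    convex : ∀ {v} → Descent v → ∀ d → d ≤ height v → ∃ λ u → height u ≡ d
    convex {v} (root i eq) d d≤ = v , ≤-antisym (≤-trans (height-minimal (dist-refl-≡ eq)) z≤n) d≤
      where
      dist-refl-≡ : ∀ {u v} → u ≡ v → DistLe G u v 0
      dist-refl-≡ refl = dist-refl
    convex {v} (down e eq D) d d≤ with m≤n⇒m<n∨m≡n d≤
    ... | inj₂ d≡ = v , ≡-sym d≡
    ... | inj₁ d< = convex D d (s≤s⁻¹ (subst (d <_) eq d<))

  net : Net G ρ (k * 12) (codes k)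
  net = record
    { height = height
    ; lipschitz = height-lipschitz
    ; convex = λ v → convex (descent v)
    ; size = proj₁ slots
    ; point = point
    ; covers = covers
    ; code = code
    ; code-injective = λ {x} {y} eq w →
        let j≡ , eq′ = Fin.combine-injective _ _ _ _ eq
            w≡ , r≡ = Fin.combine-injective _ _ _ _ eq′
        in same-slot (period k) j≡ r≡ (dist-weaken (window-budget ρ (6 ^ k) {{m^n≢0 6 k}})
             (word-close (encode-injective _ _ w≡) w))
    ; local = local
    ; local-injective = λ zx zy eq →
        let j≡ , r≡ = Fin.combine-injective _ _ _ _ eq
        in same-slot 12 j≡ r≡ (dist-weaken (≤-reflexive (double ρ)) (dist-trans (dist-sym zx) zy))
    }
    where
    double : ∀ ρ → 6 * ρ + 6 * ρ ≡ 12 * ρ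
    double = solve-∀

-- The subdivided graph: distances, degrees and path-decomposition

tag : ∀ {P : Set} → Dec P → Fin 2
tag (yes _) = 0F
tag (no _)  = 1F

tag-injective : ∀ {P Q : Set} (P? : Dec P) (Q? : Dec Q) → tag P? ≡ tag Q? → (P × Q) ⊎ (¬ P × ¬ Q)
tag-injective (yes p) (yes q) _ = inj₁ (p , q)
tag-injective (no ¬p) (no ¬q) _ = inj₂ (¬p , ¬q)

∈-tabulate⁺ : ∀ {n} {p : Fin n → Bool} {i} → p i ≡ true → i ∈ tabulate p
∈-tabulate⁺ {p = p} {i} eq = Vec.lookup⇒[]= i (tabulate p) (trans (Vec.lookup∘tabulate p i) eq)

∈-tabulate⁻ : ∀ {n} {p : Fin n → Bool} {i} → i ∈ tabulate p → p i ≡ true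
∈-tabulate⁻ {p = p} {i} i∈ = trans (≡-sym (Vec.lookup∘tabulate p i)) (Vec.[]=⇒lookup i∈)

-- The vertex (x , y , i) is the i-th one on the path of length T that replaces the arc from x to y;
-- (x , x , 0) is the branch vertex x.
module Subdivision (size T : ℕ) (2≤T : 2 ≤ T) (_~_ : Fin size → Fin size → Set)
  (_~?_ : ∀ x y → Dec (x ~ y)) (~-refl : ∀ {x} → x ~ x) where

  Node : Set
  Node = Fin size × Fin size × Fin T

  -- Index 0 occurs only on the diagonal, so each branch vertex has one name. Every ordered related
  -- pair, loops included, has its own arc.
  Valid : Node → Set
  Valid (x , y , i) = (toℕ i ≡ 0 × x ≡ y) ⊎ (toℕ i ≢ 0 × x ~ y)

  -- At index 0 the target is still free; from then on it is fixed until index T - 1, whose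
  -- successor is the branch vertex of the target.
  Next : Node → Node → Set
  Next (x , y , i) (x′ , y′ , i′) =
    (toℕ i′ ≡ suc (toℕ i) × x ≡ x′ × (toℕ i ≡ 0 ⊎ y ≡ y′)) ⊎ (suc (toℕ i) ≡ T × toℕ i′ ≡ 0 × y ≡ x′)

  next? : ∀ a b → Dec (Next a b)
  next? (x , y , i) (x′ , y′ , i′) =
    (toℕ i′ ≟ suc (toℕ i) ×-dec x Fin.≟ x′ ×-dec (toℕ i ≟ 0 ⊎-dec y Fin.≟ y′))
    ⊎-dec (suc (toℕ i) ≟ T ×-dec toℕ i′ ≟ 0 ×-dec y Fin.≟ x′)

  valid? : ∀ a → Dec (Valid a)
  valid? (x , y , i) = (toℕ i ≟ 0 ×-dec x Fin.≟ y) ⊎-dec (¬? (toℕ i ≟ 0) ×-dec x ~? y)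

  valid⇒~ : ∀ {x y i} → Valid (x , y , i) → x ~ y
  valid⇒~ (inj₁ (_ , refl)) = ~-refl
  valid⇒~ (inj₂ (_ , x~y))  = x~y

  valid-branch : ∀ {x y i} → toℕ i ≡ 0 → Valid (x , y , i) → x ≡ y
  valid-branch i≡0 (inj₁ (_ , x≡y)) = x≡y
  valid-branch i≡0 (inj₂ (i≢0 , _)) = contradiction i≡0 i≢0

  next-irreflexive : ∀ {a} → ¬ Next a a
  next-irreflexive (inj₁ (i≡ , _)) = 1+n≢n (≡-sym i≡)
  next-irreflexive {_ , _ , i} (inj₂ (i+1≡T , i≡0 , _)) =
    contradiction 2≤T (<⇒≱ (s≤s (≤-reflexive (trans (≡-sym i+1≡T) (cong suc i≡0)))))

  abstract
    nodes : ∃ (Enumerates Valid)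
    nodes = enumerate-dec (↔-trans Fin.*↔× (↔-refl ×-↔ Fin.*↔×)) valid?

  open Enumerates (proj₂ nodes) public using ()
    renaming (elem to node; sound to valid; injective to node-injective; complete to node-complete)

  edge? : ∀ a b → Dec (Next a b ⊎ Next b a)
  edge? a b = next? a b ⊎-dec next? b a

  H : Graph
  H = record
    { n = proj₁ nodes
    ; adj = λ u v → does (edge? (node u) (node v))
    ; sym = λ u v → Bool.∨-comm (does (next? (node u) (node v))) _
    ; irr = λ v → dec-false (edge? (node v) (node v)) [ next-irreflexive , next-irreflexive ]′
    }

  edge⇒next : ∀ {u v} → adj H u v ≡ true → Next (node u) (node v) ⊎ Next (node v) (node u)
  edge⇒next {u} {v} = does-true (edge? (node u) (node v))

  next⇒edge : ∀ {u v} → Next (node u) (node v) → adj H u v ≡ true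
  next⇒edge {u} {v} uv = dec-true (edge? (node u) (node v)) (inj₁ uv)

  0<T : 0 < T
  0<T = ≤-trans (s≤s z≤n) 2≤T

  private
    branch-node : ∀ x → ∃ λ v → node v ≡ (x , x , fromℕ< 0<T)
    branch-node x = node-complete (x , x , fromℕ< 0<T) (inj₁ (Fin.toℕ-fromℕ< 0<T , refl))

  abstract
    branch : Fin size → V H
    branch x = proj₁ (branch-node x)

    node-branch : ∀ x → node (branch x) ≡ (x , x , fromℕ< 0<T)
    node-branch x = proj₂ (branch-node x)

    ray-node : ∀ {x y m} → x ~ y → (m<T : m < T) → m ≢ 0 → ∃ λ v → node v ≡ (x , y , fromℕ< m<T)
    ray-node x~y m<T m≢0 = node-complete _ (inj₂ (subst (_≢ 0) (≡-sym (Fin.toℕ-fromℕ< m<T)) m≢0 , x~y))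

  ray-walk : ∀ m {v x y i} → node v ≡ (x , y , i) → toℕ i ≡ m → Walk H (branch x) v m
  ray-walk zero {v} {x} {y} {i} v≡ i≡0 = subst (λ u → Walk H (branch x) u 0) (node-injective (begin
      node (branch x)         ≡⟨ node-branch x ⟩
      (x , x , fromℕ< 0<T)    ≡⟨ cong₂ (λ y i → x , y , i) x≡y (Fin.toℕ-injective (trans (Fin.toℕ-fromℕ< 0<T) (≡-sym i≡0))) ⟩
      (x , y , i)             ≡⟨ v≡ ⟨
      node v                  ∎)) here
    where
    open ≡-Reasoning
    x≡y : x ≡ y
    x≡y = valid-branch i≡0 (subst Valid v≡ (valid v))
  ray-walk (suc zero) {v} {x} v≡ i≡ = step (next⇒edge (subst₂ Next (≡-sym (node-branch x)) (≡-sym v≡)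
    (inj₁ (trans i≡ (cong suc (≡-sym (Fin.toℕ-fromℕ< 0<T))) , refl , inj₁ (Fin.toℕ-fromℕ< 0<T))))) here
  ray-walk (suc m@(suc _)) {v} {x} {y} {i} v≡ i≡ =
    let m<T = ≤-trans (≤-reflexive (≡-sym i≡)) (≤-trans (n≤1+n _) (Fin.toℕ<n i))
        u , u≡ = ray-node {x} {y} {m} (valid⇒~ {i = i} (subst Valid v≡ (valid v))) m<T λ ()
    in walk-∷ʳ (ray-walk m u≡ (Fin.toℕ-fromℕ< m<T)) (next⇒edge (subst₂ Next (≡-sym u≡) (≡-sym v≡)
         (inj₁ (trans i≡ (cong suc (≡-sym (Fin.toℕ-fromℕ< m<T))) , refl , inj₂ refl))))

  arc-walk : ∀ {x y} → x ~ y → Walk H (branch x) (branch y) T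
  arc-walk {x} {y} x~y = subst (Walk H (branch x) (branch y)) m+1≡T (walk-∷ʳ (ray-walk m u≡ (Fin.toℕ-fromℕ< m<T))
    (next⇒edge (subst₂ Next (≡-sym u≡) (≡-sym (node-branch y))
      (inj₂ (trans (cong suc (Fin.toℕ-fromℕ< m<T)) m+1≡T , Fin.toℕ-fromℕ< 0<T , refl)))))
    where
    m = pred T
    m+1≡T : suc m ≡ T
    m+1≡T = suc-pred T {{>-nonZero 0<T}}
    m<T : m < T
    m<T = ≤-reflexive m+1≡T
    last : ∃ λ v → node v ≡ (x , y , fromℕ< m<T)
    last = ray-node x~y m<T (λ m≡0 → contradiction 2≤T (<⇒≱ (s≤s (≤-reflexive (trans (≡-sym m+1≡T) (cong suc m≡0))))))
    u≡ = proj₂ last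

  ∸-next : ∀ {i j : Fin T} → toℕ j ≡ suc (toℕ i) → T ∸ toℕ i ≡ suc (T ∸ toℕ j)
  ∸-next {i} {j} eq = trans (+-∸-assoc 1 (subst (_≤ T) eq (<⇒≤ (Fin.toℕ<n j)))) (cong (λ m → suc (T ∸ m)) (≡-sym eq))

  module Metric {G : Graph} (point : Fin size → V G)
    (~⇒dist : ∀ {x y} → x ~ y → DistLe G (point x) (point y) T) where

    -- The invariant of a walk in `H` after `L` steps: continuing along the arc to either end gives
    -- a length that bounds the distance in `G`. Hence subdivision creates no shortcuts.
    Reached : V G → ℕ → Node → Set
    Reached r L (x , y , i) = DistLe G r (point x) (L + toℕ i) × DistLe G r (point y) (L + (T ∸ toℕ i))

    private
      arrive : ∀ {r L y} j → DistLe G r (point y) L → DistLe G r (point y) (suc L + j)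
      arrive {L = L} j = dist-weaken (≤-trans (n≤1+n L) (m≤m+n (suc L) j))

      depart : ∀ {r L x y} {i j : Fin T} → toℕ i ≡ 0 → toℕ j ≡ suc (toℕ i) → x ~ y →
               DistLe G r (point x) (L + toℕ i) → DistLe G r (point y) (suc L + (T ∸ toℕ j))
      depart {L = L} {i = i} {j} i≡0 j≡ x~y rx = dist-weaken (≤-reflexive (begin
          L + toℕ i + T           ≡⟨ cong (λ m → L + m + T) i≡0 ⟩
          L + 0 + T               ≡⟨ cong (_+ T) (+-identityʳ L) ⟩
          L + T                   ≡⟨ cong (λ m → L + (T ∸ m)) i≡0 ⟨
          L + (T ∸ toℕ i)         ≡⟨ cong (L +_) (∸-next {i} {j} j≡) ⟩
          L + suc (T ∸ toℕ j)     ≡⟨ +-suc L _ ⟩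
          suc L + (T ∸ toℕ j)     ∎)) (dist-trans rx (~⇒dist x~y))
        where open ≡-Reasoning

      last-∸ : ∀ {i : Fin T} → suc (toℕ i) ≡ T → T ∸ toℕ i ≡ 1
      last-∸ {i} eq = trans (cong (_∸ toℕ i) (≡-sym eq)) (m+n∸n≡m 1 (toℕ i))

    -- Along an arc the extra step pays for the change of index. On leaving a branch vertex a new
    -- end comes into play, and it is within `T` by `~⇒dist`; `reached-previous` treats the other
    -- end likewise.
    reached-next : ∀ {r L a b} → Valid a → Valid b → Next a b → Reached r L a → Reached r (suc L) b
    reached-next {L = L} {_ , _ , i} {_ , _ , j} va vb (inj₁ (j≡ , refl , inj₁ i≡0)) (rx , ry) =
        dist-weaken (+-mono-≤ (n≤1+n L) (≤-trans (n≤1+n _) (≤-reflexive (≡-sym j≡)))) rx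
      , depart {i = i} {j} i≡0 j≡ (valid⇒~ {i = j} vb) rx
    reached-next {L = L} {_ , _ , i} {_ , _ , j} va vb (inj₁ (j≡ , refl , inj₂ refl)) (rx , ry) =
        dist-weaken (+-mono-≤ (n≤1+n L) (≤-trans (n≤1+n _) (≤-reflexive (≡-sym j≡)))) rx
      , dist-weaken (≤-reflexive (trans (cong (L +_) (∸-next {i} {j} j≡)) (+-suc L _))) ry
    reached-next {r} {L} {_ , _ , i} {_ , _ , j} va vb (inj₂ (last , j≡0 , refl)) (rx , ry) =
        at-y (toℕ j)
      , subst (λ y → DistLe G r (point y) _) (valid-branch j≡0 vb) (at-y (T ∸ toℕ j))
      where
      at-y : ∀ m → DistLe G r _ (suc L + m)
      at-y m = dist-weaken (≤-trans (≤-reflexive (trans (cong (L +_) (last-∸ {i} last)) (+-comm L 1))) (m≤m+n (suc L) m)) ry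

    reached-previous : ∀ {r L a b} → Valid a → Valid b → Next a b → Reached r L b → Reached r (suc L) a
    reached-previous {r} {L} {x , y , i} {_ , y′ , j} va vb (inj₁ (j≡ , refl , y-case)) (rx , ry) = at-x , at-y y-case
      where
      at-x : DistLe G r (point x) (suc L + toℕ i)
      at-x = dist-weaken (≤-reflexive (trans (cong (L +_) j≡) (+-suc L _))) rx
      at-y : toℕ i ≡ 0 ⊎ y ≡ y′ → DistLe G r (point y) (suc L + (T ∸ toℕ i))
      at-y (inj₁ i≡0)  = dist-weaken (+-monoʳ-≤ (suc L) (≤-trans (≤-reflexive i≡0) z≤n))
                           (subst (λ y → DistLe G r (point y) (suc L + toℕ i)) (valid-branch i≡0 va) at-x)
      at-y (inj₂ refl) = dist-weaken (+-mono-≤ (n≤1+n L) (≤-trans (n≤1+n _) (≤-reflexive (≡-sym (∸-next {i} {j} j≡))))) ry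
    reached-previous {r} {L} {x , y , i} {_ , _ , j} va vb (inj₂ (last , j≡0 , refl)) (rx , ry) =
        dist-weaken (≤-reflexive (begin
          L + toℕ j + T          ≡⟨ cong (λ m → L + m + T) j≡0 ⟩
          L + 0 + T              ≡⟨ cong₂ _+_ (+-identityʳ L) (≡-sym last) ⟩
          L + suc (toℕ i)        ≡⟨ +-suc L (toℕ i) ⟩
          suc L + toℕ i          ∎)) (dist-trans rx (dist-sym (~⇒dist (valid⇒~ {i = i} va))))
      , arrive (T ∸ toℕ i) (dist-weaken (≤-reflexive (trans (cong (L +_) j≡0) (+-identityʳ L))) rx)
      where open ≡-Reasoning

    reached-walk : ∀ {r L d u v} → Walk H u v d → Reached r L (node u) → Reached r (L + d) (node v)
    reached-walk {r} {L} {v = v} here R = subst (λ m → Reached r m (node v)) (≡-sym (+-identityʳ L)) R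
    reached-walk {r} {L} {suc d} {u} {v} (step {w = w} e W) R =
      subst (λ m → Reached r m (node v)) (≡-sym (+-suc L d)) (reached-walk W (one (edge⇒next e)))
      where
      one : Next (node u) (node w) ⊎ Next (node w) (node u) → Reached r (suc L) (node w)
      one (inj₁ uw) = reached-next (valid u) (valid w) uw R
      one (inj₂ wu) = reached-previous (valid w) (valid u) wu R

    branch-dist : ∀ {x y d} → DistLe H (branch x) (branch y) d → DistLe G (point x) (point y) d
    branch-dist {x} {y} (L , L≤d , W) = dist-weaken
      (≤-trans (≤-reflexive (trans (cong (L +_) (Fin.toℕ-fromℕ< 0<T)) (+-identityʳ L))) L≤d)
      (proj₁ (subst (Reached (point x) L) (node-branch y) (reached-walk {L = 0} W
        (subst (Reached (point x) 0) (≡-sym (node-branch x)) (dist-refl , dist-refl)))))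

  module Degree (~-sym : ∀ {x y} → x ~ y → y ~ x) {κ : ℕ} (local : Fin size → Fin κ)
    (local-injective : ∀ {z x y} → z ~ x → z ~ y → local x ≡ local y → x ≡ y) where

    source target : Node → Fin size
    source (x , _ , _) = x
    target (_ , y , _) = y

    private
      not-both : ∀ {i j : Fin T} → suc (toℕ i) ≡ T → toℕ j ≢ suc (toℕ i)
      not-both {j = j} last j≡ = <⇒≢ (Fin.toℕ<n j) (trans j≡ last)

      node-≡ : ∀ {x x′ y y′ : Fin size} {i j : Fin T} → x ≡ x′ → y ≡ y′ → toℕ i ≡ toℕ j →
               (x , y , i) ≡ (x′ , y′ , j)
      node-≡ refl refl eq = cong (λ i → _ , _ , i) (Fin.toℕ-injective eq)

    -- Only a branch vertex has several successors. Their targets are all related to it, so `local`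
    -- separates them.
    next-unique : ∀ {a b c} → Valid b → Valid c → Next a b → Next a c →
                  local (target b) ≡ local (target c) → b ≡ c
    next-unique {b = _ , _ , j} {_ , _ , j′} vb vc (inj₁ (j≡ , refl , _)) (inj₁ (j′≡ , refl , _)) eq =
      node-≡ refl (local-injective (valid⇒~ {i = j} vb) (valid⇒~ {i = j′} vc) eq) (trans j≡ (≡-sym j′≡))
    next-unique {_ , _ , i} {_ , _ , j} _ _ (inj₁ (j≡ , _)) (inj₂ (last , _)) _ =
      contradiction j≡ (not-both {i} {j} last)
    next-unique {_ , _ , i} {c = _ , _ , j′} _ _ (inj₂ (last , _)) (inj₁ (j′≡ , _)) _ =
      contradiction j′≡ (not-both {i} {j′} last)
    next-unique vb vc (inj₂ (_ , j≡0 , refl)) (inj₂ (_ , j′≡0 , refl)) _ =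
      node-≡ refl (trans (≡-sym (valid-branch j≡0 vb)) (valid-branch j′≡0 vc)) (trans j≡0 (≡-sym j′≡0))

    -- Several predecessors occur only at a branch vertex; they are the last nodes of arcs with
    -- different sources, all related to it.
    previous-unique : ∀ {a b c} → Valid b → Valid c → Next b a → Next c a →
                      local (source b) ≡ local (source c) → b ≡ c
    previous-unique {b = _ , _ , i} {_ , _ , i′} vb vc (inj₁ (j≡ , refl , yb)) (inj₁ (j≡′ , refl , yc)) _ =
      node-≡ refl (same-target (toℕ i ≟ 0)) i≡i′
      where
      i≡i′ : toℕ i ≡ toℕ i′
      i≡i′ = suc-injective (trans (≡-sym j≡) j≡′)
      same-target : Dec (toℕ i ≡ 0) → _ ≡ _
      same-target (yes i≡0) = trans (≡-sym (valid-branch i≡0 vb)) (valid-branch (trans (≡-sym i≡i′) i≡0) vc)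
      same-target (no i≢0)  = trans (nonzero i≢0 yb) (≡-sym (nonzero (i≢0 ∘ trans i≡i′) yc))
        where
        nonzero : ∀ {m} {x y : Fin size} → m ≢ 0 → m ≡ 0 ⊎ x ≡ y → x ≡ y
        nonzero m≢0 (inj₁ m≡0) = contradiction m≡0 m≢0
        nonzero _   (inj₂ x≡y) = x≡y
    previous-unique {_ , _ , j} {_ , _ , i} _ _ (inj₁ (j≡ , _)) (inj₂ (_ , j≡0 , _)) _ =
      contradiction (trans (≡-sym j≡0) j≡) λ ()
    previous-unique {_ , _ , j} {c = _ , _ , i} _ _ (inj₂ (_ , j≡0 , _)) (inj₁ (j≡ , _)) _ =
      contradiction (trans (≡-sym j≡0) j≡) λ ()
    previous-unique {b = _ , _ , i} {_ , _ , i′} vb vc (inj₂ (last , _ , refl)) (inj₂ (last′ , _ , refl)) eq =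
      node-≡ (local-injective (~-sym (valid⇒~ {i = i} vb)) (~-sym (valid⇒~ {i = i′} vc)) eq) refl
        (suc-injective (trans last (≡-sym last′)))

    private
      side : Node → {P : Set} → Dec P → Fin κ
      side a (yes _) = local (target a)
      side a (no _)  = local (source a)

      neighbour-unique : ∀ {a b c} → Valid b → Valid c → (ab? : Dec (Next a b)) (ac? : Dec (Next a c)) →
                         Next a b ⊎ Next b a → Next a c ⊎ Next c a →
                         tag ab? ≡ tag ac? → side b ab? ≡ side c ac? → b ≡ c
      neighbour-unique vb vc (yes ab) (yes ac) _ _ _ eq = next-unique vb vc ab ac eq
      neighbour-unique vb vc (no _) (no _) (inj₂ ba) (inj₂ ca) _ eq = previous-unique vb vc ba ca eq
      neighbour-unique _ _ (no ¬ab) (no _) (inj₁ ab) _ _ _ = contradiction ab ¬ab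
      neighbour-unique _ _ (no _) (no ¬ac) _ (inj₁ ac) _ _ = contradiction ac ¬ac

    -- A neighbour is coded by its direction and by the `local` value of its target or source.
    degree-≤ : ∀ v → degree H v ≤ 2 * κ
    degree-≤ v = ∣tabulate∣≤ (adj H v) (λ w → combine (tag (arc? w)) (side (node w) (arc? w)))
      λ u w vu vw eq → let t≡ , l≡ = Fin.combine-injective (tag (arc? u)) (side (node u) (arc? u)) (tag (arc? w)) _ eq
                       in node-injective (neighbour-unique (valid u) (valid w) (arc? u) (arc? w)
                            (edge⇒next {v} {u} vu) (edge⇒next {v} {w} vw) t≡ l≡)
      where
      arc? : ∀ w → Dec (Next (node v) (node w))
      arc? w = next? (node v) (node w)

  module Levels (h : Fin size → ℕ) (~⇒within : ∀ {x y} → x ~ y → Within (h x) (h y) T) where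

    -- Both ends are at most T apart in height, so this is a 1-Lipschitz interpolation which first
    -- rises from h x and then falls to h y, hence takes every value at most twice.
    level : Fin size → Fin size → ℕ → ℕ
    level x y i = (h x + i) ⊓ (h y + (T ∸ i))

    nodeLevel : Node → ℕ
    nodeLevel (x , y , i) = level x y (toℕ i)

    private
      ⊓-within : ∀ {p p′ q q′ d} → Within p p′ d → Within q q′ d → Within (p ⊓ q) (p′ ⊓ q′) d
      ⊓-within {p} {p′} {q} {q′} {d} (a , a′) (b , b′) =
          ≤-trans (⊓-mono-≤ a b) (≤-reflexive (≡-sym (+-distribʳ-⊓ d p′ q′)))
        , ≤-trans (⊓-mono-≤ a′ b′) (≤-reflexive (≡-sym (+-distribʳ-⊓ d p q)))

    level-suc : ∀ x y {i} → i < T → Within (level x y i) (level x y (suc i)) 1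
    level-suc x y {i} i<T = ⊓-within
      (within-≡ 1 (trans (+-suc (h x) i) (+-comm 1 (h x + i))))
      (within-sym (within-≡ 1 (trans (cong (h y +_) (+-∸-assoc 1 i<T)) (trans (+-suc (h y) _) (+-comm 1 _)))))

    level-start : ∀ {x y} → x ~ y → level x y 0 ≡ h x
    level-start {x} {y} x~y = trans (cong (_⊓ (h y + T)) (+-identityʳ (h x))) (m≤n⇒m⊓n≡m (proj₁ (~⇒within x~y)))

    level-end : ∀ {x y} → x ~ y → level x y T ≡ h y
    level-end {x} {y} x~y = trans (cong ((h x + T) ⊓_) (trans (cong (h y +_) (n∸n≡0 T)) (+-identityʳ (h y))))
      (m≥n⇒m⊓n≡n (proj₂ (~⇒within x~y)))

    -- All arcs at a branch vertex give it the same level, namely its height, so consecutive nodes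
    -- can be compared within one arc.
    next-level : ∀ {a b} → Valid a → Valid b → Next a b → Within (nodeLevel a) (nodeLevel b) 1
    next-level {x , y , i} {_ , y′ , j} va vb (inj₁ (j≡ , refl , y-case)) =
      subst₂ (λ l m → Within l (level x y′ m) 1) (same-start y-case) (≡-sym j≡) (level-suc x y′ (Fin.toℕ<n i))
      where
      same-start : toℕ i ≡ 0 ⊎ y ≡ y′ → level x y′ (toℕ i) ≡ level x y (toℕ i)
      same-start (inj₂ refl) = refl
      same-start (inj₁ i≡0)  = trans (cong (level x y′) i≡0) (trans (level-start (valid⇒~ {i = j} vb))
        (≡-sym (trans (cong (level x y) i≡0) (level-start (valid⇒~ {i = i} va)))))
    next-level {x , y , i} {_ , y′ , j} va vb (inj₂ (last , j≡0 , refl)) =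
      subst (λ l → Within (level x y (toℕ i)) l 1)
        (trans (cong (level x y) last) (trans (level-end (valid⇒~ {i = i} va))
          (≡-sym (trans (cong (level y y′) j≡0) (level-start (valid⇒~ {i = j} vb))))))
        (level-suc x y (Fin.toℕ<n i))

    private
      level-near-source : ∀ {x y i} → x ~ y → i ≤ T → Within (h x) (level x y i) T
      level-near-source {x} {y} {i} x~y i≤T =
          ≤-trans (⊓-glb (≤-trans (m≤m+n (h x) i) (m≤m+n (h x + i) T))
                         (≤-trans (proj₁ (~⇒within x~y)) (+-monoˡ-≤ T (m≤m+n (h y) (T ∸ i)))))
                  (≤-reflexive (≡-sym (+-distribʳ-⊓ T (h x + i) (h y + (T ∸ i)))))
        , ≤-trans (m⊓n≤m _ _) (+-monoʳ-≤ (h x) i≤T)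

      level-near-target : ∀ {x y i} → x ~ y → Within (h y) (level x y i) T
      level-near-target {x} {y} {i} x~y =
          ≤-trans (⊓-glb (≤-trans (proj₂ (~⇒within x~y)) (+-monoˡ-≤ T (m≤m+n (h x) i)))
                         (≤-trans (m≤m+n (h y) (T ∸ i)) (m≤m+n (h y + (T ∸ i)) T)))
                  (≤-reflexive (≡-sym (+-distribʳ-⊓ T (h x + i) (h y + (T ∸ i)))))
        , ≤-trans (m⊓n≤n _ _) (+-monoʳ-≤ (h y) (m∸n≤m T i))

    levelOf : V H → ℕ
    levelOf v = nodeLevel (node v)

    edge-level : ∀ {u v} → adj H u v ≡ true → Within (levelOf u) (levelOf v) 1
    edge-level {u} {v} e with edge⇒next {u} {v} e
    ... | inj₁ uv = next-level (valid u) (valid v) uv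
    ... | inj₂ vu = within-sym (next-level (valid v) (valid u) vu)

    inBag? : ∀ l v → Dec (levelOf v ≡ l ⊎ levelOf v ≡ suc l)
    inBag? l v = levelOf v ≟ l ⊎-dec levelOf v ≟ suc l

    -- An edge changes the level by at most one, so two consecutive levels per bag suffice to cover
    -- it.
    bagAt : ℕ → Subset (n H)
    bagAt l = tabulate (λ v → does (inBag? l v))

    private
      ∈bag⁺ : ∀ {l v} → levelOf v ≡ l ⊎ levelOf v ≡ suc l → v ∈ bagAt l
      ∈bag⁺ {l} {v} p = ∈-tabulate⁺ (dec-true (inBag? l v) p)

      ∈bag⁻ : ∀ {l v} → v ∈ bagAt l → levelOf v ≡ l ⊎ levelOf v ≡ suc l
      ∈bag⁻ {l} {v} v∈ = does-true (inBag? l v) (∈-tabulate⁻ v∈)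

      maxLevel : ∃ λ B → ∀ v → levelOf v ≤ B
      maxLevel = bounded levelOf

      bagIndex : V H → Fin (suc (proj₁ maxLevel))
      bagIndex v = fromℕ< (s≤s (proj₂ maxLevel v))

      toℕ-bagIndex : ∀ v → toℕ (bagIndex v) ≡ levelOf v
      toℕ-bagIndex v = Fin.toℕ-fromℕ< (s≤s (proj₂ maxLevel v))

      between : ∀ {l i j k} → i ≤ j → j ≤ k → l ≡ i ⊎ l ≡ suc i → l ≡ k ⊎ l ≡ suc k → l ≡ j ⊎ l ≡ suc j
      between {l} {i} {j} {k} i≤j j≤k li lk with m≤n⇒m<n∨m≡n (≤-trans j≤k (k≤l lk))
        where
        k≤l : l ≡ k ⊎ l ≡ suc k → k ≤ l
        k≤l (inj₁ refl) = ≤-refl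
        k≤l (inj₂ refl) = n≤1+n k
      ... | inj₂ j≡l = inj₁ (≡-sym j≡l)
      ... | inj₁ j<l = inj₂ (≤-antisym (≤-trans (l≤ li) (s≤s i≤j)) j<l)
        where
        l≤ : l ≡ i ⊎ l ≡ suc i → l ≤ suc i
        l≤ (inj₁ refl) = n≤1+n i
        l≤ (inj₂ refl) = ≤-refl

    decomposition : PathDecomposition H
    decomposition = record
      { ℓ = suc (proj₁ maxLevel)
      ; bag = bagAt ∘ toℕ
      ; vcover = λ v → bagIndex v , ∈bag⁺ (inj₁ (≡-sym (toℕ-bagIndex v)))
      ; ecover = ecover′
      ; interp = λ i j k v i≤j j≤k vi vk → ∈bag⁺ (between i≤j j≤k (∈bag⁻ vi) (∈bag⁻ vk))
      }
      where
      one-above : ∀ {u v} → levelOf u ≤ levelOf v → levelOf v ≤ levelOf u + 1 → v ∈ bagAt (toℕ (bagIndex u))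
      one-above {u} {v} u≤v v≤u+1 with m≤n⇒m<n∨m≡n u≤v
      ... | inj₂ u≡v = ∈bag⁺ (inj₁ (trans (≡-sym u≡v) (≡-sym (toℕ-bagIndex u))))
      ... | inj₁ u<v = ∈bag⁺ (inj₂ (trans (≤-antisym (subst (levelOf v ≤_) (+-comm (levelOf u) 1) v≤u+1) u<v)
                                          (cong suc (≡-sym (toℕ-bagIndex u)))))
      ecover′ : ∀ u v → adj H u v ≡ true → ∃[ i ] (u ∈ bagAt (toℕ i) × v ∈ bagAt (toℕ i))
      ecover′ u v e with edge-level {u} {v} e | ≤-total (levelOf u) (levelOf v)
      ... | _ , v≤u+1 | inj₁ u≤v = bagIndex u , ∈bag⁺ (inj₁ (≡-sym (toℕ-bagIndex u))) , one-above u≤v v≤u+1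
      ... | u≤v+1 , _ | inj₂ v≤u = bagIndex v , one-above v≤u u≤v+1 , ∈bag⁺ (inj₁ (≡-sym (toℕ-bagIndex v)))

    module Width {M : ℕ} (code : Fin size → Fin M)
      (code-injective : ∀ {x y} → code x ≡ code y → Within (h x) (h y) (T + T) → x ≡ y) where

      private
        Rising : Node → Set
        Rising (x , y , i) = h x + toℕ i ≤ h y + (T ∸ toℕ i)

        rising? : ∀ a → Dec (Rising a)
        rising? (x , y , i) = h x + toℕ i ≤? h y + (T ∸ toℕ i)

        -- Both ends of an arc are within `T` of the level of each of its nodes, so ends of two
        -- nodes at one level are within 2T and the codes determine them. On the rising or the
        -- falling half the level then determines the index.
        node-unique : ∀ {a b} → Valid a → Valid b → nodeLevel a ≡ nodeLevel b →
                      code (proj₁ a) ≡ code (proj₁ b) → code (proj₁ (proj₂ a)) ≡ code (proj₁ (proj₂ b)) →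
                      tag (rising? a) ≡ tag (rising? b) → a ≡ b
        node-unique {x , y , i} {x′ , y′ , j} va vb l≡ cx cy t≡ with
            code-injective cx (within-trans T T (level-near-source (valid⇒~ {i = i} va) (<⇒≤ (Fin.toℕ<n i)))
              (subst (λ l → Within l (h x′) T) (≡-sym l≡) (within-sym (level-near-source (valid⇒~ {i = j} vb) (<⇒≤ (Fin.toℕ<n j))))))
          | code-injective cy (within-trans T T (level-near-target {x} {y} {toℕ i} (valid⇒~ {i = i} va))
              (subst (λ l → Within l (h y′) T) (≡-sym l≡) (within-sym (level-near-target {x′} {y′} {toℕ j} (valid⇒~ {i = j} vb)))))
        ... | refl | refl = cong (λ i → x , y , i) (Fin.toℕ-injective (index (tag-injective (rising? (x , y , i)) (rising? (x , y , j)) t≡)))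
          where
          index : _ ⊎ _ → toℕ i ≡ toℕ j
          index (inj₁ (ri , rj)) = +-cancelˡ-≡ (h x) _ _
            (trans (≡-sym (m≤n⇒m⊓n≡m ri)) (trans l≡ (m≤n⇒m⊓n≡m rj)))
          index (inj₂ (fi , fj)) = ∸-cancelˡ-≡ (<⇒≤ (Fin.toℕ<n i)) (<⇒≤ (Fin.toℕ<n j)) (+-cancelˡ-≡ (h y) _ _
            (trans (≡-sym (m≥n⇒m⊓n≡n (≰⇒≥ fi))) (trans l≡ (m≥n⇒m⊓n≡n (≰⇒≥ fj)))))

      -- A node of a bag is coded by its two ends, the half of its arc, and which of the two levels
      -- it has.
      bag-size : ∀ l → ∣ bagAt l ∣ ≤ M * (M * (2 * 2))
      bag-size l = ∣tabulate∣≤ (λ v → does (inBag? l v)) bagCode unique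
        where
        low? : ∀ v → Dec (levelOf v ≡ l)
        low? v = levelOf v ≟ l
        bagCode : V H → Fin (M * (M * (2 * 2)))
        bagCode v = let (x , y , _) = node v in
          combine (code x) (combine (code y) (combine (tag (rising? (node v))) (tag (low? v))))
        same-level : ∀ {u v} → levelOf u ≡ l ⊎ levelOf u ≡ suc l → levelOf v ≡ l ⊎ levelOf v ≡ suc l →
                     (levelOf u ≡ l × levelOf v ≡ l) ⊎ (levelOf u ≢ l × levelOf v ≢ l) → levelOf u ≡ levelOf v
        same-level _ _ (inj₁ (ul , vl)) = trans ul (≡-sym vl)
        same-level (inj₁ ul) _ (inj₂ (u≢ , _)) = contradiction ul u≢
        same-level _ (inj₁ vl) (inj₂ (_ , v≢)) = contradiction vl v≢
        same-level (inj₂ ul) (inj₂ vl) (inj₂ _) = trans ul (≡-sym vl)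
        unique : ∀ u v → does (inBag? l u) ≡ true → does (inBag? l v) ≡ true → bagCode u ≡ bagCode v → u ≡ v
        unique u v u∈ v∈ eq =
          let cx , eq₁ = Fin.combine-injective (code (proj₁ (node u))) _ (code (proj₁ (node v))) _ eq
              cy , eq₂ = Fin.combine-injective (code (proj₁ (proj₂ (node u)))) _ (code (proj₁ (proj₂ (node v)))) _ eq₁
              r≡ , l≡  = Fin.combine-injective (tag (rising? (node u))) (tag (low? u)) (tag (rising? (node v))) (tag (low? v)) eq₂
          in node-injective (node-unique {node u} {node v} (valid u) (valid v)
               (same-level {u} {v} (does-true (inBag? l u) u∈) (does-true (inBag? l v) v∈) (tag-injective (low? u) (low? v) l≡))
               cx cy r≡)

      width-≤ : HasWidthAtMost decomposition (M * (M * (2 * 2)))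
      width-≤ i = bag-size (toℕ i)

-- From a net to the partition and the quasi-isometry

module FromNet {G : Graph} {ρ κ M : ℕ} (1≤ρ : 1 ≤ ρ) (net : Net G ρ κ M) where

  open Net net

  module _ where
    private
      instance
        2ρ-nonZero : NonZero (2 * ρ)
        2ρ-nonZero = m*n≢0 2 ρ {{_}} {{>-nonZero 1≤ρ}}

      layer : V G → ℕ
      layer v = height v / (2 * ρ)

      Bounded : ℕ → Set
      Bounded L = ∀ v → layer v < L

      layers : ∃ λ L → Bounded L × (∀ i → Bounded i → L ≤ i)
      layers = let B , le = bounded layer in
        least (λ L → Fin.all? λ v → layer v <? L) (suc B) (s≤s ∘ le)

      part : V G → Fin (proj₁ layers)
      part v = fromℕ< (proj₁ (proj₂ layers) v)

      toℕ-part : ∀ v → toℕ (part v) ≡ layer v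
      toℕ-part v = Fin.toℕ-fromℕ< (proj₁ (proj₂ layers) v)

      -- The number of layers is minimal, so some vertex lies in layer `i` or above; by `convex` the
      -- height 2ρi is then attained.
      part-nonempty : ∀ i → ∃ λ v → part v ≡ i
      part-nonempty i =
        let v , ¬v<i = Fin.¬∀⟶∃¬ _ _ (λ v → layer v <? toℕ i) λ b → <⇒≱ (Fin.toℕ<n i) (proj₂ (proj₂ layers) (toℕ i) b)
            u , u≡ = convex v (toℕ i * (2 * ρ)) (≤-trans (*-monoˡ-≤ (2 * ρ) (≮⇒≥ ¬v<i)) (m/n*n≤m (height v) (2 * ρ)))
        in u , Fin.toℕ-injective (trans (toℕ-part u) (trans (cong (_/ (2 * ρ)) u≡) (m*n/n≡m (toℕ i) (2 * ρ))))

      -- Heights in layer `l` are within 2ρ of 2ρl, and passing to a net point costs another 2ρ.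
      InWindow : ℕ → Fin size → Set
      InWindow l x = Within (height (point x)) (l * (2 * ρ)) (4 * ρ)

      window : ∀ l → ∃ (Enumerates (InWindow l))
      window l = enumerate-dec ↔-refl λ x → within? _ _ _

      -- Two points of a window differ in height by at most 8ρ ≤ 12ρ, where `code` is injective.
      window-size : ∀ l → proj₁ (window l) ≤ M
      window-size l = Fin.injective⇒≤ {f = code ∘ elem} λ {i} {j} eq → injective (code-injective eq
        (within-weaken (≤-trans (≤-reflexive (≡-sym (*-distribʳ-+ ρ 4 4))) (*-monoˡ-≤ ρ (m≤m+n 8 4)))
          (within-trans (4 * ρ) (4 * ρ) (sound i) (within-sym (sound j)))))
        where open Enumerates (proj₂ (window l))

      height-layer : ∀ v → Within (height v) (layer v * (2 * ρ)) (2 * ρ)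
      height-layer v =
          ≤-trans (≤-reflexive (m≡m%n+[m/n]*n (height v) (2 * ρ)))
            (≤-trans (≤-reflexive (+-comm _ (layer v * (2 * ρ)))) (+-monoʳ-≤ (layer v * (2 * ρ)) (m%n≤n (height v) (2 * ρ))))
        , ≤-trans (m/n*n≤m (height v) (2 * ρ)) (m≤m+n _ _)

      part-covered : ∀ i → ∃[ D ] (length D ≤ M × (∀ v → part v ≡ i → ∃[ x ] (x ∈ˡ D × DistLe G v x (2 * ρ))))
      part-covered i = List.tabulate (point ∘ elem) ,
          ≤-trans (≤-reflexive (List.length-tabulate (point ∘ elem))) (window-size (toℕ i)) , centre
        where
        open Enumerates (proj₂ (window (toℕ i)))
        centre : ∀ v → part v ≡ i → _
        centre v refl =
          let x , d = covers v
              j , j≡ = complete x (subst (λ l → InWindow l x) (≡-sym (toℕ-part v))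
                (within-weaken (≤-reflexive (≡-sym (*-distribʳ-+ ρ 2 2)))
                  (within-trans (2 * ρ) (2 * ρ) (within-sym (lipschitz d)) (height-layer v))))
          in point x , subst (λ x → point x ∈ˡ List.tabulate (point ∘ elem)) j≡ (Membership.∈-tabulate⁺ j) , d

    partition : ∀ {F} → M ≤ F → GoodPartition G ρ F
    partition M≤F = proj₁ layers , part , part-nonempty
      , (λ i → let D , le , cov = part-covered i in D , ≤-trans le M≤F , cov)
      , λ u v d → within-one (subst₂ (λ a b → Within a b 1) (≡-sym (toℕ-part u)) (≡-sym (toℕ-part v))
          (/-lipschitz (2 * ρ) (lipschitz d)))

  -- Vertices at distance 2ρ have centres at distance at most 2ρ + 4ρ. The ratio of 6ρ to 2ρ is the
  -- multiplicative constant 3.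
  T : ℕ
  T = 6 * ρ

  _~_ : Fin size → Fin size → Set
  x ~ y = DistLe G (point x) (point y) T

  private
    2≤T : 2 ≤ T
    2≤T = ≤-trans (s≤s (s≤s z≤n)) (*-monoʳ-≤ 6 1≤ρ)

    ~⇒within : ∀ {x y} → x ~ y → Within (height (point x)) (height (point y)) T
    ~⇒within = lipschitz

  open Subdivision size T 2≤T _~_ (λ x y → dist? (point x) (point y) T) (dist-refl)
  open Metric {G} point (λ d → d)
  open Degree dist-sym local local-injective
  open Levels (height ∘ point) ~⇒within
  open Width code (λ eq w → code-injective eq (subst (Within _ _) (≡-sym (*-distribʳ-+ ρ 6 6)) w))

  centre : V G → Fin size
  centre v = proj₁ (covers v)

  φ : V G → V H
  φ v = branch (centre v)

  private
    ball-ball : ∀ ρ d → 2 * ρ + d + 2 * ρ ≡ d + 4 * ρ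
    ball-ball = solve-∀

  centre-dist : ∀ {u v d} → DistLe G u v d → DistLe G (point (centre u)) (point (centre v)) (d + 4 * ρ)
  centre-dist {u} {v} {d} uv = dist-weaken (≤-reflexive (ball-ball ρ d))
    (dist-trans (dist-trans (dist-sym (proj₂ (covers u))) uv) (proj₂ (covers v)))

  dist-centre : ∀ {u v d} → DistLe G (point (centre u)) (point (centre v)) d → DistLe G u v (d + 4 * ρ)
  dist-centre {u} {v} {d} uv = dist-weaken (≤-reflexive (ball-ball ρ d))
    (dist-trans (dist-trans (proj₂ (covers u)) uv) (dist-sym (proj₂ (covers v))))

  close-step : ∀ {u v} → DistLe G u v (2 * ρ) → DistLe H (φ u) (φ v) T
  close-step {u} {v} uv = dist-walk (arc-walk
    (subst (DistLe G (point (centre u)) (point (centre v))) (≡-sym (*-distribʳ-+ ρ 2 4)) (centre-dist uv)))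

  -- A walk is cut into pieces of length 2ρ, each of which is mapped to an arc of length 6ρ.
  walk-bound : ∀ c {u v L} → L ≤ c * (2 * ρ) → Walk G u v L → DistLe H (φ u) (φ v) (3 * L + T)
  walk-bound zero z≤n here = dist-refl
  walk-bound (suc c) {u} {v} {L} L≤ W with ≤-total L (2 * ρ)
  ... | inj₁ L≤2ρ = dist-weaken (m≤n+m T (3 * L)) (close-step (L , L≤2ρ , W))
  ... | inj₂ 2ρ≤L with L′ , refl ← ≤⇒≡+ 2ρ≤L =
    let w , A , B = walk-split (2 * ρ) W
    in dist-weaken (≤-reflexive (pieces ρ L′))
         (dist-trans (close-step (dist-walk A)) (walk-bound c (+-cancelˡ-≤ (2 * ρ) L′ _ L≤) B))
    where
    pieces : ∀ ρ L → 6 * ρ + (3 * L + 6 * ρ) ≡ 3 * (2 * ρ + L) + 6 * ρ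
    pieces = solve-∀

  quasi-isometry : IsQuasiIsometry G H 3 (12 * ρ) φ
  quasi-isometry = lower , upper , dense
    where
    lower : ∀ u v d → DistLe H (φ u) (φ v) d → DistLe G u v (3 * d + 3 * (12 * ρ))
    lower u v d uv = dist-weaken
      (+-mono-≤ (m≤n*m d 3) (≤-trans (*-monoˡ-≤ ρ (m≤m+n 4 32)) (≤-reflexive (*-assoc 3 12 ρ))))
      (dist-centre (branch-dist uv))
    upper : ∀ u v d → DistLe G u v d → DistLe H (φ u) (φ v) (3 * d + 12 * ρ)
    upper u v d (L , L≤d , W) = dist-weaken (+-mono-≤ (*-monoʳ-≤ 3 L≤d) (*-monoˡ-≤ ρ (m≤m+n 6 6)))
      -- The number of pieces only bounds the recursion, so the crude choice `L` will do.
      (walk-bound L (m≤m*n L (2 * ρ) {{m*n≢0 2 ρ {{_}} {{>-nonZero 1≤ρ}}}}) W)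
    dense : ∀ w → ∃[ u ] DistLe H w (φ u) (12 * ρ)
    -- The centre chosen for `point x` may differ from `x`, so a second arc is followed after the
    -- return to `branch x`: 6ρ + 6ρ.
    dense w = point x , dist-weaken (≤-reflexive (≡-sym (*-distribʳ-+ ρ 6 6)))
      (dist-trans (dist-sym (toℕ i , <⇒≤ (Fin.toℕ<n i) , ray-walk (toℕ i) refl refl))
        (dist-walk (arc-walk (dist-weaken (*-monoˡ-≤ ρ (m≤m+n 2 4)) (proj₂ (covers (point x)))))))
      where
      x = proj₁ (node w)
      i = proj₂ (proj₂ (node w))

  quasi-isometric-graph : ∀ {b} → 2 * κ < b →
    ∃[ H ] (PathwidthAtMost H (M * (M * (2 * 2))) × MaxDegreeLessThan H b × QuasiIsometric G H 3 (12 * ρ))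
  quasi-isometric-graph 2κ<b =
    H , (decomposition , width-≤) , (λ v → ≤-<-trans (degree-≤ v) 2κ<b) , φ , quasi-isometry

-- Growth of the bound and assembly

coverBound : ℕ → ℕ
coverBound k = codes k * (codes k * (2 * 2))

module _ where
  open ≤-Reasoning

  -- For k ≥ 44 the constants 4, 6 and 44 can be replaced by `k`, which leaves the exponent 3k + 4 ≤
  -- 7k.
  codes-≤ : ∀ k → 44 ≤ k → codes k ≤ k ^ (7 * k)
  codes-≤ k 44≤k = begin
    k * ((4 * k) ^ suc k * (44 * 6 ^ k))    ≤⟨ *-monoʳ-≤ k (*-mono-≤ (^-monoˡ-≤ (suc k) (*-monoˡ-≤ k 4≤k)) (*-mono-≤ 44≤k (^-monoˡ-≤ k 6≤k))) ⟩
    k * ((k * k) ^ suc k * k ^ suc k)       ≡⟨ cong (λ m → k * ((k * m) ^ suc k * k ^ suc k)) (*-identityʳ k) ⟨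
    k * ((k ^ 2) ^ suc k * k ^ suc k)       ≡⟨ cong (λ m → k * (m * k ^ suc k)) (^-*-assoc k 2 (suc k)) ⟩
    k * (k ^ (2 * suc k) * k ^ suc k)       ≡⟨ cong (k *_) (^-distribˡ-+-* k (2 * suc k) (suc k)) ⟨
    k ^ suc (2 * suc k + suc k)             ≤⟨ ^-monoʳ-≤ k {{>-nonZero (≤-trans (s≤s z≤n) 44≤k)}} exponent ⟩
    k ^ (7 * k)                             ∎
    where
    4≤k : 4 ≤ k
    4≤k = ≤-trans (m≤m+n 4 40) 44≤k
    6≤k : 6 ≤ k
    6≤k = ≤-trans (m≤m+n 6 38) 44≤k
    exponent : suc (2 * suc k + suc k) ≤ 7 * k
    exponent = lin (suc (2 * suc k + suc k)) (7 * k) (3 * k) 4≤k (solve (k ∷ []))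

  coverBound-≤ : ∀ k → 44 ≤ k → coverBound k ≤ k ^ (15 * k)
  coverBound-≤ k 44≤k = begin
    codes k * (codes k * 4)                  ≤⟨ *-mono-≤ (codes-≤ k 44≤k) (*-mono-≤ (codes-≤ k 44≤k) (≤-trans (m≤m+n 4 40) 44≤k)) ⟩
    k ^ (7 * k) * (k ^ (7 * k) * k)          ≡⟨ cong (λ m → k ^ (7 * k) * (k ^ (7 * k) * m)) (*-identityʳ k) ⟨
    k ^ (7 * k) * (k ^ (7 * k) * k ^ 1)      ≡⟨ cong (k ^ (7 * k) *_) (^-distribˡ-+-* k (7 * k) 1) ⟨
    k ^ (7 * k) * k ^ (7 * k + 1)            ≡⟨ ^-distribˡ-+-* k (7 * k) (7 * k + 1) ⟨
    k ^ (7 * k + (7 * k + 1))                ≤⟨ ^-monoʳ-≤ k {{>-nonZero 1≤k}} exponent ⟩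
    k ^ (15 * k)                             ∎
    where
    1≤k : 1 ≤ k
    1≤k = ≤-trans (s≤s z≤n) 44≤k
    exponent : 7 * k + (7 * k + 1) ≤ 15 * k
    exponent = lin (7 * k + (7 * k + 1)) (15 * k) 0 1≤k (solve (k ∷ []))

theorem1p2 : Σ (ℕ → ℕ) λ f → IsKToTheOk f ×
    (∀ (k ρ : ℕ) → 1 ≤ k → 1 ≤ ρ → (G : Graph) → GeodesicCoverable G k ρ →
    (∃[ H ] (PathwidthAtMost H (f k) × MaxDegreeLessThan H (26 * k) × QuasiIsometric G H 3 (12 * ρ)))
    × GoodPartition G ρ (f k))
theorem1p2 = coverBound , (15 , 44 , coverBound-≤) , construct
  where
  construct : ∀ k ρ → 1 ≤ k → 1 ≤ ρ → (G : Graph) → GeodesicCoverable G k ρ → _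
  construct k ρ 1≤k 1≤ρ G (P , covered) =
    quasi-isometric-graph degree-budget , partition (m≤m*4m (codes k))
    where
    open FromNet 1≤ρ (net 1≤ρ P covered)
    -- Two directions, and 12 net points on each of the `k` paths.
    degree-budget : 2 * (k * 12) < 26 * k
    degree-budget = lin (suc (2 * (k * 12))) (26 * k) k 1≤k (solve (k ∷ []))
    m≤m*4m : ∀ m → m ≤ m * (m * 4)
    m≤m*4m zero      = z≤n
    m≤m*4m m@(suc _) = m≤m*n m (m * 4)
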